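{- There is an always-terminating algorithm that, given an initial sequent $\Omega;\Sigma\vdash\sigma$, decides whether it is valid in MuACL.
   Context: Fix finite sets $\mathit{Res}$ of resources and $\mathit{Usr}$ of users, and a set of predicate symbols $p$ with arities. MuACL propositions are of four kinds ($\multimap\!\!\multimap$ is a primitive binary connective, "linear contractual implication"): $\sigma ::= I \mid res@usr \mid \sigma\otimes\sigma$; $\delta ::= I \mid res@usr\multimap res'@usr' \mid \delta\otimes\delta$; $\theta ::= \delta \multimap\!\!\multimap \delta$; $\omega ::= \top \mid p(usr_1,\dots,usr_n) \mid \omega\land\omega \mid \omega\to\omega \mid G(\theta) \mid G(\delta)$. Since $\otimes$ is associative and commutative, tensor products are identified with multisets of their factors, $I$ being the empty multiset; $\delta\subseteq\delta'$ is multiset inclusion. $\Sigma,\Delta,\Theta,\Omega$ (possibly primed) are finite multisets of propositions $\sigma,\delta,\theta,\omega$ respectively; comma is multiset union. Judgments are $\Omega\Vdash\omega$ and sequents $\Omega;\Theta,\Delta,\Sigma\vdash\sigma$; empty components are omitted. A sequent is initial if $\Theta$ and $\Delta$ are empty (written $\Omega;\Sigma\vdash\sigma$). Below $\Gamma$ abbreviates $\Theta,\Delta,\Sigma$, $\Gamma'$ abbreviates $\Theta',\Delta',\Sigma'$, and "premises / conclusion" denotes a rule. The rules of MuACL are: Non-linear: ($\top$-right) $\Vdash\top$. ($\Omega$-Ax) $\omega\Vdash\omega$. (Cont) $\Omega,\omega,\omega\Vdash\omega'$ / $\Omega,\omega\Vdash\omega'$. (Weak) $\Omega\Vdash\omega'$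 / $\Omega,\omega\Vdash\omega'$. ($\land$-left1) $\Omega,\omega\Vdash\omega''$ / $\Omega,\omega\land\omega'\Vdash\omega''$. ($\land$-left2) $\Omega,\omega'\Vdash\omega''$ / $\Omega,\omega\land\omega'\Vdash\omega''$. ($\land$-right) $\Omega\Vdash\omega$ and $\Omega'\Vdash\omega'$ / $\Omega,\Omega'\Vdash\omega\land\omega'$. ($\to$-left) $\Omega\Vdash\omega$ and $\Omega',\omega'\Vdash\omega''$ / $\Omega,\omega\to\omega',\Omega'\Vdash\omega''$. ($\to$-right) $\Omega,\omega\Vdash\omega'$ / $\Omega\Vdash\omega\to\omega'$. Non-linear L-rules: (L-Cont) $\Omega,\omega,\omega;\Gamma\vdash\sigma$ / $\Omega,\omega;\Gamma\vdash\sigma$. (L-Weak) $\Omega;\Gamma\vdash\sigma$ / $\Omega,\omega;\Gamma\vdash\sigma$. (L-$\land$-left1) $\Omega,\omega;\Gamma\vdash\sigma$ / $\Omega,\omega\land\omega';\Gamma\vdash\sigma$. (L-$\land$-left2) $\Omega,\omega';\Gamma\vdash\sigma$ / $\Omega,\omega\land\omega';\Gamma\vdash\sigma$. (L-$\to$-left) $\Omega\Vdash\omega$ and $\Omega',\omega';\Gamma\vdash\sigma$ / $\Omega,\omega\to\omega',\Omega';\Gamma\vdash\sigma$. Linear: ($I$-right) $\vdash I$. ($\Sigma$-Ax) $\Omega;res@usr\vdash res@usr$. ($\otimes$-left-$\Theta$), ($\otimes$-left-$\Delta$), ($\otimes$-left-$\Sigma$): from a sequent with $x,y$ among its left linear formulas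 of kind $\theta$, $\delta$, $\sigma$ respectively, infer the same sequent with $x\otimes y$ in place of $x,y$. ($\otimes$-right) $\Omega;\Gamma\vdash\sigma$ and $\Omega;\Gamma'\vdash\sigma'$ / $\Omega;\Gamma,\Gamma'\vdash\sigma\otimes\sigma'$. ($\multimap$-left) $\Omega;\Sigma\vdash res@usr$ / $\Omega;\Sigma,res@usr\multimap res'@usr'\vdash res'@usr'$. ($\multimap\!\!\multimap$-left) if $\delta\subseteq\delta'$: $\Omega;\Theta,\Delta,\delta',\Sigma\vdash\sigma$ / $\Omega;\Theta,\delta\multimap\!\!\multimap\delta',\Delta,\Sigma\vdash\sigma$. ($\multimap\!\!\multimap$-split) $\Omega;\Theta,(\delta\otimes\delta'')\multimap\!\!\multimap(\delta'\otimes\delta'''),\Delta,\Sigma\vdash\sigma$ / $\Omega;\Theta,\delta\multimap\!\!\multimap\delta',\delta''\multimap\!\!\multimap\delta''',\Delta,\Sigma\vdash\sigma$. Interaction: ($G$-left-$\theta$) $\Omega;\Theta,\theta,\Delta,\Sigma\vdash\sigma$ / $\Omega,G(\theta);\Theta,\Delta,\Sigma\vdash\sigma$. ($G$-left-$\delta$) $\Omega;\Theta,\Delta,\delta,\Sigma\vdash\sigma$ / $\Omega,G(\delta);\Theta,\Delta,\Sigma\vdash\sigma$. ($\Omega$-cut) $\Omega\Vdash\omega$ and $\Omega',\omega;\Gamma\vdash\sigma$ / $\Omega,\Omega';\Gamma\vdash\sigma$. A sequent is valid if it has a proof, i.e. a finite derivation tree all of whose leaves are axioms. -}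

module Defs where

open import Data.Fin.Base using (Fin)
open import Data.List.Base using (List; []; _∷_; _++_)
open import Data.List.NonEmpty.Base using (List⁺; toList; _⁺++⁺_) renaming ([_] to [_]⁺)
open import Data.List.Relation.Binary.Permutation.Homogeneous using (Permutation)
open import Data.List.Relation.Binary.Permutation.Propositional using (_↭_)
open import Data.Nat.Base using (ℕ)
open import Data.Product.Base using (∃)
open import Data.Vec.Base using (Vec)
open import Function.Bundles using (_↔_)
open import Relation.Binary.Core using (Rel)
open import Relation.Binary.Definitions using (DecidableEquality)
open import Level using (0ℓ)

-- The set of predicate symbols may be infinite. Its elements occur in the
-- input of the decision procedure, so equality on them must be decidable
-- (for resources and users this follows from finiteness).
record Signature : Set₁ where
  field
    Res Usr    : Set
    #Res #Usr  : ℕ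
    Res-finite : Res ↔ Fin #Res
    Usr-finite : Usr ↔ Fin #Usr
    Pred       : Set
    _≟ₚ_       : DecidableEquality Pred
    arity      : Pred → ℕ

-- A tensor product is identified with the multiset of its factors. Multisets
-- are lists taken up to permutation.
Tensor : Set → Set
Tensor A = List A

module _ {A : Set} where

  infixr 6 _⊗_

  I : Tensor A
  I = []

  ⟦_⟧ : A → Tensor A
  ⟦ a ⟧ = a ∷ []

  _⊗_ : Tensor A → Tensor A → Tensor A
  _⊗_ = _++_

  _⊆ₘ_ : Rel (Tensor A) 0ℓ
  x ⊆ₘ y = ∃ λ z → x ⊗ z ↭ y

module MuACL (𝒮 : Signature) where
  open Signature 𝒮

  infix  9 _at_
  infix  8 _⊸_
  infix  5 _⊸⊸_
  infixr 4 _∧_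
  infixr 3 _⇒_

  data Atom : Set where
    _at_ : Res → Usr → Atom

  data Exchange : Set where
    _⊸_ : Atom → Atom → Exchange

  σ-Prop : Set
  σ-Prop = Tensor Atom

  δ-Prop : Set
  δ-Prop = Tensor Exchange

  data θ-Prop : Set where
    _⊸⊸_ : δ-Prop → δ-Prop → θ-Prop

  data ω-Prop : Set where
    ⊤       : ω-Prop
    pred    : (p : Pred) → Vec Usr (arity p) → ω-Prop
    _∧_ _⇒_ : ω-Prop → ω-Prop → ω-Prop
    Gθ      : θ-Prop → ω-Prop
    Gδ      : δ-Prop → ω-Prop

  -- The grammar of θ has no tensor, yet the calculus has a left rule for
  -- tensors of θ's. The Θ-component of a sequent therefore consists of
  -- nonempty tensors of θ's (there is no unit of this kind), while G applies
  -- to a single θ only. No rule read upwards from a sequent with empty Θ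
  -- introduces a proper tensor of θ's.
  θ-Tensor : Set
  θ-Tensor = List⁺ θ-Prop

  -- The identification of tensors with multisets, lifted to the remaining
  -- syntax.

  data _≈θ_ : Rel θ-Prop 0ℓ where
    _⊸⊸_ : ∀ {δ₁ δ₁′ δ₂ δ₂′} → δ₁ ↭ δ₁′ → δ₂ ↭ δ₂′ →
           (δ₁ ⊸⊸ δ₂) ≈θ (δ₁′ ⊸⊸ δ₂′)

  data _≈ω_ : Rel ω-Prop 0ℓ where
    ⊤    : ⊤ ≈ω ⊤
    pred : ∀ p us → pred p us ≈ω pred p us
    _∧_  : ∀ {ω₁ ω₁′ ω₂ ω₂′} → ω₁ ≈ω ω₁′ → ω₂ ≈ω ω₂′ → (ω₁ ∧ ω₂) ≈ω (ω₁′ ∧ ω₂′)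
    _⇒_  : ∀ {ω₁ ω₁′ ω₂ ω₂′} → ω₁ ≈ω ω₁′ → ω₂ ≈ω ω₂′ → (ω₁ ⇒ ω₂) ≈ω (ω₁′ ⇒ ω₂′)
    Gθ   : ∀ {θ θ′} → θ ≈θ θ′ → Gθ θ ≈ω Gθ θ′
    Gδ   : ∀ {δ δ′} → δ ↭ δ′ → Gδ δ ≈ω Gδ δ′

  _≈θ⊗_ : Rel θ-Tensor 0ℓ
  t ≈θ⊗ t′ = Permutation _≈θ_ (toList t) (toList t′)

  variable
    a b                   : Atom
    σ σ′                  : σ-Prop
    x y                   : Tensor Atom
    δ δ′ δ″ δ‴            : δ-Prop
    θ                     : θ-Prop
    t t′                  : θ-Tensor
    ω ω′ ω″               : ω-Prop
    Σ Σ′                  : List σ-Prop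
    Δ Δ′                  : List δ-Prop
    Θ Θ′                  : List θ-Tensor
    Ω Ω′                  : List ω-Prop

  infix 1 _⊩_ _⨾_∣_∣_⊢_

  -- In both calculi the rule exch makes the components multisets and
  -- propositions equal up to the identification interchangeable. All other
  -- rules display their principal formulas at the head.

  data _⊩_ : List ω-Prop → ω-Prop → Set where
    exch    : Permutation _≈ω_ Ω Ω′ → ω ≈ω ω′ → Ω ⊩ ω → Ω′ ⊩ ω′
    ⊤-right : [] ⊩ ⊤
    Ω-Ax    : ω ∷ [] ⊩ ω
    Cont    : ω ∷ ω ∷ Ω ⊩ ω′ → ω ∷ Ω ⊩ ω′
    Weak    : Ω ⊩ ω′ → ω ∷ Ω ⊩ ω′
    ∧-left₁ : ω ∷ Ω ⊩ ω″ → (ω ∧ ω′) ∷ Ω ⊩ ω″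
    ∧-left₂ : ω′ ∷ Ω ⊩ ω″ → (ω ∧ ω′) ∷ Ω ⊩ ω″
    ∧-right : Ω ⊩ ω → Ω′ ⊩ ω′ → Ω ++ Ω′ ⊩ ω ∧ ω′
    ⇒-left  : Ω ⊩ ω → ω′ ∷ Ω′ ⊩ ω″ → (ω ⇒ ω′) ∷ Ω ++ Ω′ ⊩ ω″
    ⇒-right : ω ∷ Ω ⊩ ω′ → Ω ⊩ ω ⇒ ω′

  -- Ω ⨾ Θ ∣ Δ ∣ Σ ⊢ σ is the type of finite derivations of the sequent
  -- Ω;Θ,Δ,Σ ⊢ σ.
  data _⨾_∣_∣_⊢_ : List ω-Prop → List θ-Tensor → List δ-Prop → List σ-Prop →
                   σ-Prop → Set where

    exch : Permutation _≈ω_ Ω Ω′ → Permutation _≈θ⊗_ Θ Θ′ →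
           Permutation _↭_ Δ Δ′ → Permutation _↭_ Σ Σ′ → σ ↭ σ′ →
           Ω ⨾ Θ ∣ Δ ∣ Σ ⊢ σ → Ω′ ⨾ Θ′ ∣ Δ′ ∣ Σ′ ⊢ σ′

    L-Cont    : ω ∷ ω ∷ Ω ⨾ Θ ∣ Δ ∣ Σ ⊢ σ → ω ∷ Ω ⨾ Θ ∣ Δ ∣ Σ ⊢ σ
    L-Weak    : Ω ⨾ Θ ∣ Δ ∣ Σ ⊢ σ → ω ∷ Ω ⨾ Θ ∣ Δ ∣ Σ ⊢ σ
    L-∧-left₁ : ω ∷ Ω ⨾ Θ ∣ Δ ∣ Σ ⊢ σ → (ω ∧ ω′) ∷ Ω ⨾ Θ ∣ Δ ∣ Σ ⊢ σ
    L-∧-left₂ : ω′ ∷ Ω ⨾ Θ ∣ Δ ∣ Σ ⊢ σ → (ω ∧ ω′) ∷ Ω ⨾ Θ ∣ Δ ∣ Σ ⊢ σ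
    L-⇒-left  : Ω ⊩ ω → ω′ ∷ Ω′ ⨾ Θ ∣ Δ ∣ Σ ⊢ σ →
                (ω ⇒ ω′) ∷ Ω ++ Ω′ ⨾ Θ ∣ Δ ∣ Σ ⊢ σ

    I-right  : [] ⨾ [] ∣ [] ∣ [] ⊢ I
    Σ-Ax     : Ω ⨾ [] ∣ [] ∣ ⟦ a ⟧ ∷ [] ⊢ ⟦ a ⟧
    ⊗-left-Θ : Ω ⨾ t ∷ t′ ∷ Θ ∣ Δ ∣ Σ ⊢ σ → Ω ⨾ (t ⁺++⁺ t′) ∷ Θ ∣ Δ ∣ Σ ⊢ σ
    ⊗-left-Δ : Ω ⨾ Θ ∣ δ ∷ δ′ ∷ Δ ∣ Σ ⊢ σ → Ω ⨾ Θ ∣ (δ ⊗ δ′) ∷ Δ ∣ Σ ⊢ σ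
    ⊗-left-Σ : Ω ⨾ Θ ∣ Δ ∣ x ∷ y ∷ Σ ⊢ σ → Ω ⨾ Θ ∣ Δ ∣ (x ⊗ y) ∷ Σ ⊢ σ
    ⊗-right  : Ω ⨾ Θ ∣ Δ ∣ Σ ⊢ σ → Ω ⨾ Θ′ ∣ Δ′ ∣ Σ′ ⊢ σ′ →
               Ω ⨾ Θ ++ Θ′ ∣ Δ ++ Δ′ ∣ Σ ++ Σ′ ⊢ σ ⊗ σ′
    ⊸-left   : Ω ⨾ [] ∣ [] ∣ Σ ⊢ ⟦ a ⟧ →
               Ω ⨾ [] ∣ ⟦ a ⊸ b ⟧ ∷ [] ∣ Σ ⊢ ⟦ b ⟧
    ⊸⊸-left  : δ ⊆ₘ δ′ → Ω ⨾ Θ ∣ δ′ ∷ Δ ∣ Σ ⊢ σ →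
               Ω ⨾ [ δ ⊸⊸ δ′ ]⁺ ∷ Θ ∣ Δ ∣ Σ ⊢ σ
    ⊸⊸-split : Ω ⨾ [ (δ ⊗ δ″) ⊸⊸ (δ′ ⊗ δ‴) ]⁺ ∷ Θ ∣ Δ ∣ Σ ⊢ σ →
               Ω ⨾ [ δ ⊸⊸ δ′ ]⁺ ∷ [ δ″ ⊸⊸ δ‴ ]⁺ ∷ Θ ∣ Δ ∣ Σ ⊢ σ

    G-left-θ : Ω ⨾ [ θ ]⁺ ∷ Θ ∣ Δ ∣ Σ ⊢ σ → Gθ θ ∷ Ω ⨾ Θ ∣ Δ ∣ Σ ⊢ σ
    G-left-δ : Ω ⨾ Θ ∣ δ ∷ Δ ∣ Σ ⊢ σ → Gδ δ ∷ Ω ⨾ Θ ∣ Δ ∣ Σ ⊢ σ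
    Ω-cut    : Ω ⊩ ω → ω ∷ Ω′ ⨾ Θ ∣ Δ ∣ Σ ⊢ σ → Ω ++ Ω′ ⨾ Θ ∣ Δ ∣ Σ ⊢ σ

  ValidInitial : List ω-Prop → List σ-Prop → σ-Prop → Set
  ValidInitial Ω Σ σ = Ω ⨾ [] ∣ [] ∣ Σ ⊢ σ

{-# OPTIONS --safe #-}
module Submission where

-- In a derivation of an initial sequent every exchange comes out of Ω through
-- G, and the rule ⊸-left applies to a sequent with a single linear exchange and
-- a single goal. Hence a valid initial sequent matches each atom of Σ with an
-- atom of σ, and the exchanges that are introduced before the goals are
-- separated, taken together, serve each goal at most once, so their number is
-- at most |σ|. Above such an exchange there is again an initial sequent from
-- one atom to one atom, which amounts to a path in the finite graph of
-- exchanges that can be produced alone. The contracts used may be merged into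
-- one, and those that contribute no exchange may be dropped, which leaves a
-- finite search.
--
-- It remains to know which formulas G(θ), G(δ) follow from Ω. Saturating Ω
-- within its subformulas produces a world of a finite Kripke model that forces
-- exactly the members of the saturated set. Completeness of the cut-free
-- calculus for the Kripke model of contexts turns these members back into
-- derivable judgments.

open import Defs
open import Data.Empty using (⊥)
open import Data.Fin.Base using (Fin)
open import Data.Fin.Properties using () renaming (_≟_ to _≟ᶠ_)
open import Data.List.Base
  using (List; []; _∷_; _++_; length; map; concat; concatMap; filter; allFin;
         cartesianProduct; cartesianProductWith)
open import Data.List.Membership.Propositional using (_∈_; find; lose)
open import Data.List.Membership.Propositional.Properties
  using (∈-∃++; ∈-++⁺ˡ; ∈-++⁺ʳ; ∈-++⁻; ∈-filter⁺; ∈-filter⁻; ∈-concatMap⁺; ∈-concatMap⁻;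
         ∈-cartesianProduct⁺; ∈-cartesianProductWith⁺; ∈-map⁺; ∈-allFin)
open import Data.List.NonEmpty.Base using (toList; _∷_)
import Data.List.Properties as List
open import Data.List.Properties
  using (filter-notAll; concatMap-++; concat-++; map-++; ++-conicalˡ; length-map; length-++-≤ʳ; length-++-≤ˡ)
open import Data.List.Relation.Binary.Permutation.Homogeneous as Hom using (Permutation)
import Data.List.Relation.Binary.Permutation.Propositional as ↭
open import Data.List.Relation.Binary.Permutation.Propositional
  using (_↭_; ↭-refl; ↭-reflexive; ↭-sym; ↭-trans; prep; swap)
open import Data.List.Relation.Binary.Permutation.Propositional.Properties
  using (++-comm; ++-assoc; ++-identityʳ; ++⁺; ++⁺ʳ; ++⁺ˡ; shift; shifts; drop-mid; ∈-resp-↭;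
         ↭-length; ↭-empty-inv; ↭-singleton-inv; ++-commutativeMonoid)
  renaming (map⁺ to ↭-map⁺)
open import Data.List.Relation.Binary.Pointwise as Pointwise using ([]; _∷_)
open import Data.List.Relation.Binary.Subset.Propositional using (_⊆_)
open import Data.List.Relation.Unary.All as All using (All; []; _∷_)
open import Data.List.Relation.Unary.All.Properties using (++⁻ˡ; ++⁻ʳ) renaming (++⁺ to All-++⁺)
open import Data.List.Relation.Unary.Any as Any using (Any; here; there)
open import Data.Nat.Base using (zero; suc; _≤_; _<_; z≤n; s≤s)
open import Data.Nat.Properties using (≤-refl; ≤-trans; ≤-reflexive)
open import Data.Product.Base using (∃; _×_; _,_; proj₁; proj₂; uncurry)
open import Data.Sum.Base using (_⊎_; inj₁; inj₂; [_,_]′)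
open import Data.Unit.Base using (tt) renaming (⊤ to Unit)
import Data.Vec.Properties as Vec
open import Function.Base using (_∘_; id; case_of_)
open import Function.Bundles using (_↔_; Inverse)
open import Function.Properties.Inverse using (↔⇒↣)
open import Level using (0ℓ)
open import Relation.Binary.Construct.Closure.ReflexiveTransitive as Star using (Star; ε; _◅_; _◅◅_)
open import Relation.Binary.Core using (Rel)
open import Relation.Binary.Definitions using (DecidableEquality; Decidable)
open import Relation.Binary.PropositionalEquality using (_≡_; _≢_; refl; sym; trans; cong; cong₂; subst)
open import Relation.Nullary.Decidable using (Dec; yes; no; map′; _×-dec_; _⊎-dec_; ¬?; via-injection)
open import Relation.Nullary.Negation using (¬_; contradiction)

-- Lists up to permutation, and contexts with structural rules

module _ {A : Set} {R : Rel A 0ℓ} where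

  All-resp-Permutation : {P : A → Set} → (∀ {x y} → R x y → P x → P y) →
    ∀ {xs ys} → Permutation R xs ys → All P xs → All P ys
  All-resp-Permutation f (Hom.refl rs) ps = Pointwise.All-resp-Pointwise f rs ps
  All-resp-Permutation f (Hom.prep r π) (p ∷ ps) = f r p ∷ All-resp-Permutation f π ps
  All-resp-Permutation f (Hom.swap r s π) (p ∷ q ∷ ps) = f s q ∷ f r p ∷ All-resp-Permutation f π ps
  All-resp-Permutation f (Hom.trans π ρ) ps = All-resp-Permutation f ρ (All-resp-Permutation f π ps)

  Permutation-refl : (∀ {x} → R x x) → ∀ {xs} → Permutation R xs xs
  Permutation-refl r = Hom.refl (Pointwise.refl r)

  ↭⇒Permutation : (∀ {x} → R x x) → ∀ {xs ys} → xs ↭ ys → Permutation R xs ys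
  ↭⇒Permutation r ↭.refl         = Hom.refl (Pointwise.refl r)
  ↭⇒Permutation r (↭.prep x π)   = Hom.prep r (↭⇒Permutation r π)
  ↭⇒Permutation r (↭.swap x y π) = Hom.swap r r (↭⇒Permutation r π)
  ↭⇒Permutation r (↭.trans π ρ)  = Hom.trans (↭⇒Permutation r π) (↭⇒Permutation r ρ)

module _ {A : Set} (_≟_ : DecidableEquality A) where
  open import Data.List.Membership.DecPropositional _≟_ using (_∈?_)

  -- Multisets are cancellative, so whichever occurrence of `x` is removed from `ys`, the answer is
  -- the same and no backtracking arises.
  ⊆ₘ? : Decidable (_⊆ₘ_ {A})
  ⊆ₘ? [] ys = yes (ys , ↭-refl)
  ⊆ₘ? (x ∷ xs) ys with x ∈? ys
  ... | no x∉ys = no λ (zs , π) → x∉ys (∈-resp-↭ π (here refl))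
  ... | yes x∈ys with ∈-∃++ x∈ys
  ...   | us , vs , refl = map′
    (λ (zs , π) → zs , ↭-trans (prep x π) (↭-sym (shift x us vs)))
    (λ (zs , π) → zs , drop-mid [] us π)
    (⊆ₘ? xs (us ++ vs))

  ↭? : Decidable (_↭_ {A = A})
  ↭? [] [] = yes ↭-refl
  ↭? [] (y ∷ ys) = no λ π → case ↭-length π of λ ()
  ↭? (x ∷ xs) ys with x ∈? ys
  ... | no x∉ys = no λ π → x∉ys (∈-resp-↭ π (here refl))
  ... | yes x∈ys with ∈-∃++ x∈ys
  ...   | us , vs , refl = map′
    (λ π → ↭-trans (prep x π) (↭-sym (shift x us vs)))
    (drop-mid [] us)
    (↭? xs (us ++ vs))

module Contexts {A : Set} {P : List A → Set}
  (exchange : ∀ {xs ys} → xs ↭ ys → P xs → P ys)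
  (contract : ∀ {x xs} → P (x ∷ x ∷ xs) → P (x ∷ xs))
  (weaken   : ∀ {x xs} → P xs → P (x ∷ xs)) where

  absorb : ∀ {x xs} → x ∈ xs → P (x ∷ xs) → P xs
  absorb {x} x∈xs p with ∈-∃++ x∈xs
  ... | us , vs , refl =
    exchange (↭-sym (shift x us vs)) (contract (exchange (prep x (shift x us vs)) p))

  absorb-all : ∀ {xs} ys → ys ⊆ xs → P (ys ++ xs) → P xs
  absorb-all [] ys⊆xs p = p
  absorb-all (y ∷ ys) ys⊆xs p =
    absorb-all ys (ys⊆xs ∘ there) (absorb (∈-++⁺ʳ ys (ys⊆xs (here refl))) p)

  weaken-all : ∀ ys {xs} → P xs → P (ys ++ xs)
  weaken-all [] p = p
  weaken-all (y ∷ ys) p = weaken (weaken-all ys p)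

  -- With exchange, contraction and weakening a context counts only as a set. Both `_⊩_` and the
  -- nonlinear side of sequents are instances.
  resize : ∀ {xs ys} → xs ⊆ ys → P xs → P ys
  resize {xs} {ys} xs⊆ys p =
    absorb-all xs xs⊆ys (exchange (++-comm ys xs) (weaken-all ys p))

module _ {A : Set} where

  concat-↭ : {xss yss : List (List A)} → Permutation _↭_ xss yss → concat xss ↭ concat yss
  concat-↭ (Hom.refl [])       = ↭-refl
  concat-↭ (Hom.refl (π ∷ πs)) = ++⁺ π (concat-↭ (Hom.refl πs))
  concat-↭ (Hom.prep π πs)     = ++⁺ π (concat-↭ πs)
  concat-↭ (Hom.swap {x = x} {y} π ρ πs) = ↭-trans (shifts x y) (++⁺ ρ (++⁺ π (concat-↭ πs)))
  concat-↭ (Hom.trans πs ρs)   = ↭-trans (concat-↭ πs) (concat-↭ ρs)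

map-Permutation : {A B : Set} {R : Rel A 0ℓ} {S : Rel B 0ℓ} (f : A → B) →
  (∀ {x y} → R x y → S (f x) (f y)) →
  ∀ {xs ys} → Permutation R xs ys → Permutation S (map f xs) (map f ys)
map-Permutation f r⇒s (Hom.refl rs)    = Hom.refl (Pointwise.map⁺ f f (Pointwise.map r⇒s rs))
map-Permutation f r⇒s (Hom.prep r π)   = Hom.prep (r⇒s r) (map-Permutation f r⇒s π)
map-Permutation f r⇒s (Hom.swap r s π) = Hom.swap (r⇒s r) (r⇒s s) (map-Permutation f r⇒s π)
map-Permutation f r⇒s (Hom.trans π ρ)  = Hom.trans (map-Permutation f r⇒s π) (map-Permutation f r⇒s ρ)

-- Exhaustive search and reachability in finite graphs

Searchable : Set → Set₁
Searchable A = ∀ {P : A → Set} → (∀ x → Dec (P x)) → Dec (∃ P)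

module _ {A : Set} where

  search-enumerated : (xs : List A) → (∀ x → x ∈ xs) → Searchable A
  search-enumerated xs ∈xs P? = map′ Any.satisfied (λ (x , p) → lose (∈xs x) p) (Any.any? P? xs)

  search-members : (xs : List A) → Searchable (∃ (_∈ xs))
  search-members [] P? = no λ ()
  search-members (x ∷ xs) P? = map′
    (λ { (inj₁ p) → (_ , here refl) , p ; (inj₂ ((_ , i) , p)) → (_ , there i) , p })
    (λ { ((_ , here refl) , p) → inj₁ p ; ((_ , there i) , p) → inj₂ ((_ , i) , p) })
    (P? (x , here refl) ⊎-dec search-members xs (λ (y , i) → P? (y , there i)))

  search-lists : Searchable A → ∀ n {P : List A → Set} → (∀ xs → Dec (P xs)) →
                 Dec (∃ λ xs → length xs ≤ n × P xs)
  search-lists search zero P? = map′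
    (λ p → [] , z≤n , p)
    (λ { ([] , _ , p) → p })
    (P? [])
  search-lists search (suc n) P? = map′
    (λ { (inj₁ p) → [] , z≤n , p ; (inj₂ (x , xs , l , p)) → x ∷ xs , s≤s l , p })
    (λ { ([] , _ , p) → inj₁ p ; (x ∷ xs , s≤s l , p) → inj₂ (x , xs , l , p) })
    (P? [] ⊎-dec search λ x → search-lists search n λ xs → P? (x ∷ xs))

  Edge : List (A × A) → Rel A 0ℓ
  Edge E x y = (x , y) ∈ E

  -- A path uses the first edge of the list never, or else between its first and
  -- its last use of that edge it can be cut short.
  split-path : ∀ {u v E x y} → Star (Edge ((u , v) ∷ E)) x y →
    Star (Edge E) x y ⊎ (Star (Edge E) x u × Star (Edge E) v y)
  split-path ε = inj₁ ε
  split-path (here refl ◅ p) with split-path p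
  ... | inj₁ q       = inj₂ (ε , q)
  ... | inj₂ (_ , q) = inj₂ (ε , q)
  split-path (there i ◅ p) with split-path p
  ... | inj₁ q       = inj₁ (i ◅ q)
  ... | inj₂ (q , r) = inj₂ (i ◅ q , r)

  -- Warshall's algorithm with edges in place of vertices: the recursion removes one edge at a time,
  -- and by `split-path` a single passage through the removed edge is enough.
  path? : DecidableEquality A → ∀ E → Decidable (Star (Edge E))
  path? _≟_ [] x y = map′ (λ { refl → ε }) (λ { ε → refl }) (x ≟ y)
  path? _≟_ ((u , v) ∷ E) x y = map′
    [ Star.map there , (λ (p , q) → Star.map there p ◅◅ here refl ◅ Star.map there q) ]′
    split-path
    (path? _≟_ E x y ⊎-dec (path? _≟_ E x u ×-dec path? _≟_ E v y))

length≤concatMap : {A B : Set} (f : A → List B) → (∀ x → f x ≢ []) →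
                   ∀ xs → length xs ≤ length (concatMap f xs)
length≤concatMap f ne [] = z≤n
length≤concatMap f ne (x ∷ xs) with f x | ne x
... | []     | fx≢[] = contradiction refl fx≢[]
... | y ∷ ys | _     = s≤s (≤-trans (length≤concatMap f ne xs) (length-++-≤ʳ _ {ys}))

nonempty? : {A : Set} (xs : List A) → Dec (xs ≢ [])
nonempty? []      = no λ []≢[] → []≢[] refl
nonempty? (_ ∷ _) = yes λ ()

-- Assembling tensors on the left of a sequent

module Merging {A : Set} {P : List (Tensor A) → Set}
  (exchange : ∀ {xs ys} → xs ↭ ys → P xs → P ys)
  (merge : ∀ {x y xs} → P (x ∷ y ∷ xs) → P ((x ⊗ y) ∷ xs)) where

  -- The left tensor rules are binary, and the unit has no left rule, so only nonempty tensors can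
  -- be assembled from their factors.
  merge-factors : ∀ {x xs} → x ≢ [] → P (map ⟦_⟧ x ++ xs) → P (x ∷ xs)
  merge-factors {[]} x≢[] p = contradiction refl x≢[]
  merge-factors {a ∷ []} _ p = p
  merge-factors {a ∷ x@(_ ∷ _)} {xs} _ p = merge {⟦ a ⟧} {x} (exchange (swap x ⟦ a ⟧ ↭-refl)
    (merge-factors {x} {⟦ a ⟧ ∷ xs} (λ ()) (exchange (↭-sym (shift ⟦ a ⟧ (map ⟦_⟧ x) xs)) p)))

  merge-all-factors : ∀ {xs} ys → All (_≢ []) xs → P (map ⟦_⟧ (concat xs) ++ ys) → P (xs ++ ys)
  merge-all-factors ys [] p = p
  merge-all-factors {x ∷ xs} ys (x≢[] ∷ xs≢[]) p =
    exchange (shift x xs ys) (merge-all-factors (x ∷ ys) xs≢[]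
      (exchange (↭-sym (shift x (map ⟦_⟧ (concat xs)) ys))
        (merge-factors x≢[] (subst P (trans (cong (_++ ys) (map-++ ⟦_⟧ x (concat xs)))
          (List.++-assoc (map ⟦_⟧ x) (map ⟦_⟧ (concat xs)) ys)) p))))

-- Decidability of the identification of propositions

module _ (𝒮 : Signature) where
  open Signature 𝒮
  open MuACL 𝒮

  _≟ᵣ_ : DecidableEquality Res
  _≟ᵣ_ = via-injection (↔⇒↣ Res-finite) _≟ᶠ_

  _≟ᵤ_ : DecidableEquality Usr
  _≟ᵤ_ = via-injection (↔⇒↣ Usr-finite) _≟ᶠ_

  _≟ₐ_ : DecidableEquality Atom
  (r at u) ≟ₐ (s at v) = map′ (λ { (refl , refl) → refl }) (λ { refl → refl , refl })
    ((r ≟ᵣ s) ×-dec (u ≟ᵤ v))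

  _≟ₑ_ : DecidableEquality Exchange
  (a ⊸ b) ≟ₑ (c ⊸ d) = map′ (λ { (refl , refl) → refl }) (λ { refl → refl , refl })
    ((a ≟ₐ c) ×-dec (b ≟ₐ d))

  ≈θ-refl : θ ≈θ θ
  ≈θ-refl {_ ⊸⊸ _} = ↭-refl ⊸⊸ ↭-refl

  ≈ω-refl : ω ≈ω ω
  ≈ω-refl {⊤} = ⊤
  ≈ω-refl {pred p us} = pred p us
  ≈ω-refl {_ ∧ _} = ≈ω-refl ∧ ≈ω-refl
  ≈ω-refl {_ ⇒ _} = ≈ω-refl ⇒ ≈ω-refl
  ≈ω-refl {Gθ _} = Gθ ≈θ-refl
  ≈ω-refl {Gδ _} = Gδ ↭-refl

  ≈ω-sym : ω ≈ω ω′ → ω′ ≈ω ω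
  ≈ω-sym ⊤ = ⊤
  ≈ω-sym (pred p us) = pred p us
  ≈ω-sym (e ∧ f) = ≈ω-sym e ∧ ≈ω-sym f
  ≈ω-sym (e ⇒ f) = ≈ω-sym e ⇒ ≈ω-sym f
  ≈ω-sym (Gθ (π ⊸⊸ ρ)) = Gθ (↭-sym π ⊸⊸ ↭-sym ρ)
  ≈ω-sym (Gδ π) = Gδ (↭-sym π)

  ≈ω-trans : ω ≈ω ω′ → ω′ ≈ω ω″ → ω ≈ω ω″
  ≈ω-trans ⊤ ⊤ = ⊤
  ≈ω-trans (pred p us) (pred .p .us) = pred p us
  ≈ω-trans (e ∧ f) (e′ ∧ f′) = ≈ω-trans e e′ ∧ ≈ω-trans f f′
  ≈ω-trans (e ⇒ f) (e′ ⇒ f′) = ≈ω-trans e e′ ⇒ ≈ω-trans f f′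
  ≈ω-trans (Gθ (π ⊸⊸ ρ)) (Gθ (π′ ⊸⊸ ρ′)) = Gθ (↭-trans π π′ ⊸⊸ ↭-trans ρ ρ′)
  ≈ω-trans (Gδ π) (Gδ ρ) = Gδ (↭-trans π ρ)

  _≈ω?_ : Decidable _≈ω_
  ⊤ ≈ω? ⊤ = yes ⊤
  pred p us ≈ω? pred q vs with p ≟ₚ q
  ... | no p≢q = no λ { (pred _ _) → p≢q refl }
  ... | yes refl with Vec.≡-dec _≟ᵤ_ us vs
  ...   | yes refl = yes (pred p us)
  ...   | no us≢vs = no λ { (pred _ _) → us≢vs refl }
  (ω₁ ∧ ω₂) ≈ω? (ω₃ ∧ ω₄) = map′ (λ (e , f) → e ∧ f) (λ { (e ∧ f) → e , f })
    ((ω₁ ≈ω? ω₃) ×-dec (ω₂ ≈ω? ω₄))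
  (ω₁ ⇒ ω₂) ≈ω? (ω₃ ⇒ ω₄) = map′ (λ (e , f) → e ⇒ f) (λ { (e ⇒ f) → e , f })
    ((ω₁ ≈ω? ω₃) ×-dec (ω₂ ≈ω? ω₄))
  Gθ (δ₁ ⊸⊸ δ₂) ≈ω? Gθ (δ₃ ⊸⊸ δ₄) =
    map′ (λ (π , ρ) → Gθ (π ⊸⊸ ρ)) (λ { (Gθ (π ⊸⊸ ρ)) → π , ρ })
    (↭? _≟ₑ_ δ₁ δ₃ ×-dec ↭? _≟ₑ_ δ₂ δ₄)
  Gδ δ₁ ≈ω? Gδ δ₂ = map′ Gδ (λ { (Gδ π) → π }) (↭? _≟ₑ_ δ₁ δ₂)
  ⊤ ≈ω? pred _ _ = no λ ()
  ⊤ ≈ω? (_ ∧ _) = no λ ()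
  ⊤ ≈ω? (_ ⇒ _) = no λ ()
  ⊤ ≈ω? Gθ _ = no λ ()
  ⊤ ≈ω? Gδ _ = no λ ()
  pred _ _ ≈ω? ⊤ = no λ ()
  pred _ _ ≈ω? (_ ∧ _) = no λ ()
  pred _ _ ≈ω? (_ ⇒ _) = no λ ()
  pred _ _ ≈ω? Gθ _ = no λ ()
  pred _ _ ≈ω? Gδ _ = no λ ()
  (_ ∧ _) ≈ω? ⊤ = no λ ()
  (_ ∧ _) ≈ω? pred _ _ = no λ ()
  (_ ∧ _) ≈ω? (_ ⇒ _) = no λ ()
  (_ ∧ _) ≈ω? Gθ _ = no λ ()
  (_ ∧ _) ≈ω? Gδ _ = no λ ()
  (_ ⇒ _) ≈ω? ⊤ = no λ ()
  (_ ⇒ _) ≈ω? pred _ _ = no λ ()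
  (_ ⇒ _) ≈ω? (_ ∧ _) = no λ ()
  (_ ⇒ _) ≈ω? Gθ _ = no λ ()
  (_ ⇒ _) ≈ω? Gδ _ = no λ ()
  Gθ _ ≈ω? ⊤ = no λ ()
  Gθ _ ≈ω? pred _ _ = no λ ()
  Gθ _ ≈ω? (_ ∧ _) = no λ ()
  Gθ _ ≈ω? (_ ⇒ _) = no λ ()
  Gθ _ ≈ω? Gδ _ = no λ ()
  Gδ _ ≈ω? ⊤ = no λ ()
  Gδ _ ≈ω? pred _ _ = no λ ()
  Gδ _ ≈ω? (_ ∧ _) = no λ ()
  Gδ _ ≈ω? (_ ⇒ _) = no λ ()
  Gδ _ ≈ω? Gθ _ = no λ ()

  -- Kripke models

  record Model : Set₁ where
    infix 4 _≼_
    field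
      World    : Set
      _≼_      : Rel World 0ℓ
      ≼-refl   : ∀ {w} → w ≼ w
      ≼-trans  : ∀ {u v w} → u ≼ v → v ≼ w → u ≼ w
      V        : World → ω-Prop → Set
      V-mono   : ∀ {u v} → u ≼ v → V u ω → V v ω
      V-resp-≈ : ∀ {w} → ω ≈ω ω′ → V w ω → V w ω′

  module Forcing (ℳ : Model) where
    open Model ℳ

    infix 4 _⊨_ _⊨*_

    -- Apart from the identification of tensors, `_⊩_` never looks inside `Gθ` and `Gδ`, so both are
    -- treated as atoms.
    _⊨_ : World → ω-Prop → Set
    w ⊨ ⊤ = Unit
    w ⊨ pred p us = V w (pred p us)
    w ⊨ (ω ∧ ω′) = w ⊨ ω × w ⊨ ω′
    w ⊨ (ω ⇒ ω′) = ∀ {v} → w ≼ v → v ⊨ ω → v ⊨ ω′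
    w ⊨ Gθ θ = V w (Gθ θ)
    w ⊨ Gδ δ = V w (Gδ δ)

    _⊨*_ : World → List ω-Prop → Set
    w ⊨* Ω = All (w ⊨_) Ω

    ⊨-mono : ∀ ω {u v} → u ≼ v → u ⊨ ω → v ⊨ ω
    ⊨-mono ⊤ u≼v _ = tt
    ⊨-mono (pred p us) u≼v f = V-mono u≼v f
    ⊨-mono (ω ∧ ω′) u≼v (f , g) = ⊨-mono ω u≼v f , ⊨-mono ω′ u≼v g
    ⊨-mono (ω ⇒ ω′) u≼v f v≼w = f (≼-trans u≼v v≼w)
    ⊨-mono (Gθ θ) u≼v f = V-mono u≼v f
    ⊨-mono (Gδ δ) u≼v f = V-mono u≼v f

    ⊨*-mono : ∀ {u v} → u ≼ v → u ⊨* Ω → v ⊨* Ω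
    ⊨*-mono u≼v = All.map (λ {ω} → ⊨-mono ω u≼v)

    ⊨-resp-≈ : ∀ {w} → ω ≈ω ω′ → w ⊨ ω → w ⊨ ω′
    ⊨-resp-≈ ⊤ f = f
    ⊨-resp-≈ (pred p us) f = f
    ⊨-resp-≈ (d ∧ e) (f , g) = ⊨-resp-≈ d f , ⊨-resp-≈ e g
    ⊨-resp-≈ (d ⇒ e) f w≼v g = ⊨-resp-≈ e (f w≼v (⊨-resp-≈ (≈ω-sym d) g))
    ⊨-resp-≈ (Gθ e) f = V-resp-≈ (Gθ e) f
    ⊨-resp-≈ (Gδ e) f = V-resp-≈ (Gδ e) f

    ⊨*-resp-≈ : ∀ {w} → Permutation _≈ω_ Ω′ Ω → w ⊨* Ω → w ⊨* Ω′
    ⊨*-resp-≈ π = All-resp-Permutation ⊨-resp-≈ (Hom.sym ≈ω-sym π)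

    soundness : Ω ⊩ ω → ∀ {w} → w ⊨* Ω → w ⊨ ω
    soundness (exch π e d) fs = ⊨-resp-≈ e (soundness d (⊨*-resp-≈ π fs))
    soundness ⊤-right fs = tt
    soundness Ω-Ax (f ∷ []) = f
    soundness (Cont d) (f ∷ fs) = soundness d (f ∷ f ∷ fs)
    soundness (Weak d) (f ∷ fs) = soundness d fs
    soundness (∧-left₁ d) ((f , _) ∷ fs) = soundness d (f ∷ fs)
    soundness (∧-left₂ d) ((_ , g) ∷ fs) = soundness d (g ∷ fs)
    soundness (∧-right {Ω} d e) fs = soundness d (++⁻ˡ Ω fs) , soundness e (++⁻ʳ Ω fs)
    soundness (⇒-left {Ω} d e) (f ∷ fs) =
      soundness e (f ≼-refl (soundness d (++⁻ˡ Ω fs)) ∷ ++⁻ʳ Ω fs)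
    soundness (⇒-right d) fs w≼v f = soundness d (f ∷ ⊨*-mono w≼v fs)

  -- The model of contexts and completeness of the cut-free calculus

  ⊩-exchange : Ω ↭ Ω′ → Ω ⊩ ω → Ω′ ⊩ ω
  ⊩-exchange π = exch (↭⇒Permutation ≈ω-refl π) ≈ω-refl

  module ⊩-Contexts {ω} = Contexts {P = _⊩ ω} ⊩-exchange Cont Weak

  contextModel : Model
  contextModel = record
    { World    = List ω-Prop
    ; _≼_      = _⊆_
    ; ≼-refl   = id
    ; ≼-trans  = λ Ω⊆Ω′ Ω′⊆Ω″ → Ω′⊆Ω″ ∘ Ω⊆Ω′
    ; V        = _⊩_
    ; V-mono   = ⊩-Contexts.resize
    ; V-resp-≈ = exch (Permutation-refl ≈ω-refl)
    }

  module Context = Forcing contextModel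

  -- The sequent-calculus counterpart of a neutral term of natural deduction.
  Neutral : List ω-Prop → ω-Prop → Set
  Neutral Ω ω = ∀ {Ω′ ω′} → Ω ⊆ Ω′ → ω ∷ Ω′ ⊩ ω′ → Ω′ ⊩ ω′

  neutral⇒⊩ : Neutral Ω ω → Ω ⊩ ω
  neutral⇒⊩ n = n id (⊩-Contexts.resize (λ { (here refl) → here refl }) Ω-Ax)

  -- Normalisation by evaluation. As `_⊩_` has no cut rule, consequences are composed in the model
  -- of contexts, where composition is trivial, and `reify` turns the outcome into a derivation.
  reflect : ∀ ω → Neutral Ω ω → Ω Context.⊨ ω
  reify   : ∀ ω → Ω Context.⊨ ω → Ω ⊩ ω

  reflect ⊤ n = tt
  reflect (pred p us) n = neutral⇒⊩ n
  reflect (ω ∧ ω′) n = reflect ω (λ Ω⊆Ω′ d → n Ω⊆Ω′ (∧-left₁ d))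
                     , reflect ω′ (λ Ω⊆Ω′ d → n Ω⊆Ω′ (∧-left₂ d))
  reflect (ω ⇒ ω′) n {Ω′} Ω⊆Ω′ f = reflect ω′ λ {Ω″} Ω′⊆Ω″ d →
    n (Ω′⊆Ω″ ∘ Ω⊆Ω′)
      (⊩-Contexts.resize (λ { (here refl) → here refl
                            ; (there i) → there ([ id , id ]′ (∈-++⁻ Ω″ i)) })
        (⇒-left (⊩-Contexts.resize Ω′⊆Ω″ (reify ω f)) d))
  reflect (Gθ θ) n = neutral⇒⊩ n
  reflect (Gδ δ) n = neutral⇒⊩ n

  reify ⊤ f = ⊩-Contexts.resize (λ ()) ⊤-right
  reify (pred p us) f = f
  reify {Ω} (ω ∧ ω′) (f , g) =
    ⊩-Contexts.resize (λ i → [ id , id ]′ (∈-++⁻ Ω i)) (∧-right (reify ω f) (reify ω′ g))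
  reify (ω ⇒ ω′) f = ⇒-right (reify ω′ (f there
    (reflect ω λ ω∷Ω⊆Ω′ → ⊩-Contexts.absorb (ω∷Ω⊆Ω′ (here refl)))))
  reify (Gθ θ) f = f
  reify (Gδ δ) f = f

  context-forces : ∀ Ω → Ω Context.⊨* Ω
  context-forces Ω = All.tabulate λ {ω} ω∈Ω → reflect ω λ Ω⊆Ω′ →
    ⊩-Contexts.absorb (Ω⊆Ω′ ω∈Ω)

  -- Subformulas and saturation

  infix 4 _∈≈_ _⊆≈_

  _∈≈_ : ω-Prop → List ω-Prop → Set
  ω ∈≈ Γ = Any (ω ≈ω_) Γ

  _∈≈?_ : Decidable _∈≈_
  ω ∈≈? Γ = Any.any? (ω ≈ω?_) Γ

  _⊆≈_ : Rel (List ω-Prop) 0ℓ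
  Γ ⊆≈ Γ′ = ∀ {ω} → ω ∈≈ Γ → ω ∈≈ Γ′

  ∈≈-resp-≈ : ∀ {Γ} → ω ≈ω ω′ → ω ∈≈ Γ → ω′ ∈≈ Γ
  ∈≈-resp-≈ e = Any.map (≈ω-trans (≈ω-sym e))

  subformulas : ω-Prop → List ω-Prop
  subformulas ω@⊤          = ω ∷ []
  subformulas ω@(pred _ _) = ω ∷ []
  subformulas ω@(ω₁ ∧ ω₂)  = ω ∷ subformulas ω₁ ++ subformulas ω₂
  subformulas ω@(ω₁ ⇒ ω₂)  = ω ∷ subformulas ω₁ ++ subformulas ω₂
  subformulas ω@(Gθ _)     = ω ∷ []
  subformulas ω@(Gδ _)     = ω ∷ []

  self∈subformulas : ∀ ω → ω ∈ subformulas ω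
  self∈subformulas ⊤ = here refl
  self∈subformulas (pred _ _) = here refl
  self∈subformulas (_ ∧ _) = here refl
  self∈subformulas (_ ⇒ _) = here refl
  self∈subformulas (Gθ _) = here refl
  self∈subformulas (Gδ _) = here refl

  subformulas-trans : ∀ ω → ω′ ∈ subformulas ω → subformulas ω′ ⊆ subformulas ω
  subformulas-trans ⊤ (here refl) = id
  subformulas-trans (pred _ _) (here refl) = id
  subformulas-trans (ω₁ ∧ ω₂) (here refl) = id
  subformulas-trans (ω₁ ∧ ω₂) (there i) with ∈-++⁻ (subformulas ω₁) i
  ... | inj₁ j = there ∘ ∈-++⁺ˡ ∘ subformulas-trans ω₁ j
  ... | inj₂ j = there ∘ ∈-++⁺ʳ (subformulas ω₁) ∘ subformulas-trans ω₂ j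
  subformulas-trans (ω₁ ⇒ ω₂) (here refl) = id
  subformulas-trans (ω₁ ⇒ ω₂) (there i) with ∈-++⁻ (subformulas ω₁) i
  ... | inj₁ j = there ∘ ∈-++⁺ˡ ∘ subformulas-trans ω₁ j
  ... | inj₂ j = there ∘ ∈-++⁺ʳ (subformulas ω₁) ∘ subformulas-trans ω₂ j
  subformulas-trans (Gθ _) (here refl) = id
  subformulas-trans (Gδ _) (here refl) = id

  SubformulaClosed : List ω-Prop → Set
  SubformulaClosed F = ∀ {ω} → ω ∈ F → subformulas ω ⊆ F

  subformulas-closed : ∀ Ω → SubformulaClosed (concatMap subformulas Ω)
  subformulas-closed Ω ω∈F i with find (∈-concatMap⁻ subformulas {xs = Ω} ω∈F)
  ... | ω₀ , ω₀∈Ω , j = ∈-concatMap⁺ subformulas (Any.map (λ { refl → subformulas-trans ω₀ j i }) ω₀∈Ω)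

  module Saturation (F : List ω-Prop) (F-closed : SubformulaClosed F) where

    left∈F∧ : (ω ∧ ω′) ∈ F → ω ∈ F
    left∈F∧ {ω} i = F-closed i (there (∈-++⁺ˡ (self∈subformulas ω)))

    right∈F∧ : (ω ∧ ω′) ∈ F → ω′ ∈ F
    right∈F∧ {ω} {ω′} i = F-closed i (there (∈-++⁺ʳ (subformulas ω) (self∈subformulas ω′)))

    left∈F⇒ : (ω ⇒ ω′) ∈ F → ω ∈ F
    left∈F⇒ {ω} i = F-closed i (there (∈-++⁺ˡ (self∈subformulas ω)))

    right∈F⇒ : (ω ⇒ ω′) ∈ F → ω′ ∈ F
    right∈F⇒ {ω} {ω′} i = F-closed i (there (∈-++⁺ʳ (subformulas ω) (self∈subformulas ω′)))

    -- A saturated set is a world of a Kripke model in which the formulas of F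
    -- that hold are exactly its members: every implication missing from it is
    -- refuted, at the set itself or at a larger saturated set.
    data Saturated (Γ : List ω-Prop) : Set
    data Settled (Γ : List ω-Prop) : ω-Prop → Set

    data Saturated Γ where
      saturated : (∀ {ω} → ω ∈ F → Settled Γ ω) → Saturated Γ

    data Settled Γ where
      ⊤    : ⊤ ∈≈ Γ → Settled Γ ⊤
      pred : ∀ {p us} → Settled Γ (pred p us)
      conj : ((ω ∧ ω′) ∈≈ Γ → ω ∈≈ Γ × ω′ ∈≈ Γ) → (ω ∈≈ Γ → ω′ ∈≈ Γ → (ω ∧ ω′) ∈≈ Γ) →
             Settled Γ (ω ∧ ω′)
      holds : (ω ⇒ ω′) ∈≈ Γ → (ω ∈≈ Γ → ω′ ∈≈ Γ) → Settled Γ (ω ⇒ ω′)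
      refutedHere : ¬ ((ω ⇒ ω′) ∈≈ Γ) → ω ∈≈ Γ → ¬ (ω′ ∈≈ Γ) → Settled Γ (ω ⇒ ω′)
      refutedAbove : ∀ {Γ′} → ¬ ((ω ⇒ ω′) ∈≈ Γ) →
             Γ ⊆≈ Γ′ → Saturated Γ′ → ω ∈≈ Γ′ → ¬ (ω′ ∈≈ Γ′) → Settled Γ (ω ⇒ ω′)
      Gθ   : Settled Γ (Gθ θ)
      Gδ   : Settled Γ (Gδ δ)

    saturatedModel : Model
    saturatedModel = record
      { World    = ∃ Saturated
      ; _≼_      = λ (Γ , _) (Γ′ , _) → Γ ⊆≈ Γ′
      ; ≼-refl   = id
      ; ≼-trans  = λ Γ⊆Γ′ Γ′⊆Γ″ i → Γ′⊆Γ″ (Γ⊆Γ′ i)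
      ; V        = λ (Γ , _) ω → ω ∈≈ Γ
      ; V-mono   = λ Γ⊆Γ′ → Γ⊆Γ′
      ; V-resp-≈ = ∈≈-resp-≈
      }

    open Forcing saturatedModel

    -- The truth lemma, by simultaneous induction on the formula: for an implication each direction
    -- calls the other at the antecedent. An implication outside the set has a counterexample at
    -- hand; one inside persists to every larger world, where it cannot be refuted and therefore
    -- satisfies modus ponens.
    forced⇒member : ∀ ω {Γ} (s : Saturated Γ) → ω ∈ F → (Γ , s) ⊨ ω → ω ∈≈ Γ
    member⇒forced : ∀ ω {Γ} (s : Saturated Γ) → ω ∈ F → ω ∈≈ Γ → (Γ , s) ⊨ ω

    forced⇒member ⊤ (saturated s) i f with s i
    ... | ⊤ j = j
    forced⇒member (pred p us) s i f = f
    forced⇒member (ω ∧ ω′) S@(saturated s) i (f , g) with s i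
    ... | conj _ intro = intro (forced⇒member ω S (left∈F∧ i) f) (forced⇒member ω′ S (right∈F∧ i) g)
    forced⇒member (ω ⇒ ω′) S@(saturated s) i f with s i
    ... | holds j _ = j
    ... | refutedHere _ ω∈ ω′∉ =
      contradiction (forced⇒member ω′ S (right∈F⇒ i) (f {_ , S} id (member⇒forced ω S (left∈F⇒ i) ω∈))) ω′∉
    ... | refutedAbove _ Γ⊆Γ′ S′ ω∈ ω′∉ =
      contradiction (forced⇒member ω′ S′ (right∈F⇒ i) (f {_ , S′} Γ⊆Γ′ (member⇒forced ω S′ (left∈F⇒ i) ω∈))) ω′∉
    forced⇒member (Gθ θ) s i f = f
    forced⇒member (Gδ δ) s i f = f

    member⇒forced ⊤ s i j = tt
    member⇒forced (pred p us) s i j = j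
    member⇒forced (ω ∧ ω′) S@(saturated s) i j with s i
    ... | conj elim _ = member⇒forced ω S (left∈F∧ i) (proj₁ (elim j)) ,
                        member⇒forced ω′ S (right∈F∧ i) (proj₂ (elim j))
    member⇒forced (ω ⇒ ω′) {Γ} S i j {Γ′ , S′@(saturated s′)} Γ⊆Γ′ f
      with s′ i
    ... | holds _ mp = member⇒forced ω′ S′ (right∈F⇒ i) (mp (forced⇒member ω S′ (left∈F⇒ i) f))
    ... | refutedHere ∉ _ _ = contradiction (Γ⊆Γ′ j) ∉
    ... | refutedAbove ∉ _ _ _ _ = contradiction (Γ⊆Γ′ j) ∉
    member⇒forced (Gθ θ) s i j = j
    member⇒forced (Gδ δ) s i j = j

    module _ (ℳ : Model) where
      private module ℳ = Model ℳ
      open Forcing ℳ using ()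
        renaming (_⊨_ to _⊨ℳ_; _⊨*_ to _⊨ℳ*_; ⊨-resp-≈ to ⊨ℳ-resp-≈; ⊨*-mono to ⊨ℳ*-mono)

      infix 4 _⊫_ _⊫*_

      -- Consequence is recorded semantically, since forcing can be chained through intermediate
      -- formulas without a cut rule.
      _⊫_ : List ω-Prop → ω-Prop → Set
      Γ ⊫ ω = ∀ {w} → w ⊨ℳ* Γ → w ⊨ℳ ω

      _⊫*_ : List ω-Prop → List ω-Prop → Set
      Γ ⊫* Γ′ = ∀ {w} → w ⊨ℳ* Γ → w ⊨ℳ* Γ′

      ∈≈⇒⊫ : ∀ {Γ} → ω ∈≈ Γ → Γ ⊫ ω
      ∈≈⇒⊫ i fs = ⊨ℳ-resp-≈ (≈ω-sym (proj₂ (proj₂ (find i)))) (All.lookup fs (proj₁ (proj₂ (find i))))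

      Saturation : List ω-Prop → Set
      Saturation Γ = ∃ λ Γ′ → Γ ⊆≈ Γ′ × Saturated Γ′ × Γ ⊫* Γ′

      NewConsequence : List ω-Prop → Set
      NewConsequence Γ = ∃ λ ω → ω ∈ F × ¬ (ω ∈≈ Γ) × Γ ⊫ ω

      module _ {Γ} (saturate-with : ∀ {ω} → ω ∈ F → ¬ (ω ∈≈ Γ) → Saturation (ω ∷ Γ)) where

        settle : ∀ ω → ω ∈ F → NewConsequence Γ ⊎ Settled Γ ω
        settle ω@⊤ i with ω ∈≈? Γ
        ... | yes j = inj₂ (⊤ j)
        ... | no  j = inj₁ (_ , i , j , λ _ → tt)
        settle (pred p us) i = inj₂ pred
        settle ω@(ω₁ ∧ ω₂) i with ω ∈≈? Γ | ω₁ ∈≈? Γ | ω₂ ∈≈? Γ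
        ... | yes j | no k  | _     = inj₁ (_ , left∈F∧ i , k , λ fs → proj₁ (∈≈⇒⊫ j fs))
        ... | yes j | _     | no k  = inj₁ (_ , right∈F∧ i , k , λ fs → proj₂ (∈≈⇒⊫ j fs))
        ... | no j  | yes k | yes l = inj₁ (_ , i , j , λ fs → ∈≈⇒⊫ k fs , ∈≈⇒⊫ l fs)
        ... | yes j | yes k | yes l = inj₂ (conj (λ _ → k , l) (λ _ _ → j))
        ... | no j  | no k  | _     = inj₂ (conj (λ j′ → contradiction j′ j) (λ k′ _ → contradiction k′ k))
        ... | no j  | yes _ | no l  = inj₂ (conj (λ j′ → contradiction j′ j) (λ _ l′ → contradiction l′ l))
        settle ω@(ω₁ ⇒ ω₂) i with ω ∈≈? Γ | ω₁ ∈≈? Γ | ω₂ ∈≈? Γ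
        ... | yes j | _     | yes l = inj₂ (holds j (λ _ → l))
        ... | yes j | no k  | _     = inj₂ (holds j (λ k′ → contradiction k′ k))
        ... | yes j | yes k | no l  =
          inj₁ (_ , right∈F⇒ i , l , λ fs → ∈≈⇒⊫ j fs ℳ.≼-refl (∈≈⇒⊫ k fs))
        ... | no j  | _     | yes l =
          inj₁ (_ , i , j , λ fs w≼v _ → ∈≈⇒⊫ l (⊨ℳ*-mono w≼v fs))
        ... | no j  | yes k | no l  = inj₂ (refutedHere j k l)
        -- The antecedent is assumed and the set saturated again. If the conclusion turns up, the
        -- implication itself is a new consequence; otherwise the larger saturated set refutes it.
        ... | no j  | no k  | no l with saturate-with (left∈F⇒ i) k
        ...   | Γ′ , sub , s , con with ω₂ ∈≈? Γ′
        ...     | yes m = inj₁ (_ , i , j , λ fs w≼v f → ∈≈⇒⊫ m (con (f ∷ ⊨ℳ*-mono w≼v fs)))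
        ...     | no m  = inj₂ (refutedAbove j (λ n → sub (there n)) s (sub (here ≈ω-refl)) m)
        settle (Gθ θ) i = inj₂ Gθ
        settle (Gδ δ) i = inj₂ Gδ

        settle-all : ∀ F′ → F′ ⊆ F → NewConsequence Γ ⊎ All (Settled Γ) F′
        settle-all [] F′⊆F = inj₂ []
        settle-all (ω ∷ F′) F′⊆F with settle ω (F′⊆F (here refl)) | settle-all F′ (F′⊆F ∘ there)
        ... | inj₁ new | _ = inj₁ new
        ... | inj₂ _   | inj₁ new = inj₁ new
        ... | inj₂ s   | inj₂ ss = inj₂ (s ∷ ss)

      -- `R` lists at least the formulas of `F` still missing from `Γ`. Both uses of
      -- `saturate-with`, for a consequence found and for an antecedent assumed, add a missing
      -- formula and so strictly shorten `R`; `n` makes this recursion structural.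
      saturate-bounded : ∀ n (R : List ω-Prop) → length R < n →
        ∀ {Γ} → (∀ {ω} → ω ∈ F → ¬ (ω ∈≈ Γ) → ω ∈ R) → Saturation Γ
      saturate-bounded (suc n) R (s≤s R<n) {Γ} rest = go (settle-all saturate-with F id)
        where
        saturate-with : ∀ {ω} → ω ∈ F → ¬ (ω ∈≈ Γ) → Saturation (ω ∷ Γ)
        saturate-with {ω} ω∈F ω∉Γ = saturate-bounded n (filter fresh? R)
          (≤-trans (filter-notAll fresh? R (Any.map (λ { refl ¬ω≈ω → ¬ω≈ω ≈ω-refl }) (rest ω∈F ω∉Γ))) R<n)
          (λ {ω′} ω′∈F ω′∉ → ∈-filter⁺ fresh? (rest ω′∈F (ω′∉ ∘ there)) (ω′∉ ∘ here))
          where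
          fresh? : ∀ ω′ → Dec (¬ (ω′ ≈ω ω))
          fresh? ω′ = ¬? (ω′ ≈ω? ω)
        go : NewConsequence Γ ⊎ All (Settled Γ) F → Saturation Γ
        go (inj₂ s) = Γ , id , saturated (All.lookup s) , id
        go (inj₁ (ω , ω∈F , ω∉Γ , con)) with saturate-with ω∈F ω∉Γ
        ... | Γ′ , sub , s , con′ = Γ′ , (λ i → sub (there i)) , s , λ fs → con′ (con fs ∷ fs)

      saturate : ∀ Γ → Saturation Γ
      saturate Γ = saturate-bounded (suc (length F)) F ≤-refl (λ ω∈F _ → ω∈F)

  -- Plans

  left right : θ-Prop → δ-Prop
  left  (δ ⊸⊸ _) = δ
  right (_ ⊸⊸ δ) = δ

  lefts rights : List θ-Prop → δ-Prop
  lefts  = concatMap left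
  rights = concatMap right

  tensorLefts tensorRights : List θ-Tensor → δ-Prop
  tensorLefts  = concatMap (lefts ∘ toList)
  tensorRights = concatMap (rights ∘ toList)

  lefts-resp : ∀ {xs ys} → Permutation _≈θ_ xs ys → lefts xs ↭ lefts ys
  lefts-resp π = concat-↭ (map-Permutation left (λ { (ρ ⊸⊸ _) → ρ }) π)

  rights-resp : ∀ {xs ys} → Permutation _≈θ_ xs ys → rights xs ↭ rights ys
  rights-resp π = concat-↭ (map-Permutation right (λ { (_ ⊸⊸ ρ) → ρ }) π)

  tensorLefts-resp : Permutation _≈θ⊗_ Θ Θ′ → tensorLefts Θ ↭ tensorLefts Θ′
  tensorLefts-resp π = concat-↭ (map-Permutation (lefts ∘ toList) lefts-resp π)

  tensorRights-resp : Permutation _≈θ⊗_ Θ Θ′ → tensorRights Θ ↭ tensorRights Θ′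
  tensorRights-resp π = concat-↭ (map-Permutation (rights ∘ toList) rights-resp π)

  elements : ∀ {A : Set} {n} → A ↔ Fin n → List A
  elements A↔Fin = map (Inverse.from A↔Fin) (allFin _)

  ∈-elements : ∀ {A : Set} {n} (A↔Fin : A ↔ Fin n) x → x ∈ elements A↔Fin
  ∈-elements A↔Fin x = subst (_∈ elements A↔Fin) (Inverse.strictlyInverseʳ A↔Fin x)
    (∈-map⁺ (Inverse.from A↔Fin) (∈-allFin (Inverse.to A↔Fin x)))

  atoms : List Atom
  atoms = cartesianProductWith _at_ (elements Res-finite) (elements Usr-finite)

  ∈-atoms : ∀ a → a ∈ atoms
  ∈-atoms (r at u) = ∈-cartesianProductWith⁺ _at_ (∈-elements Res-finite r) (∈-elements Usr-finite u)

  search-atoms : Searchable Atom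
  search-atoms = search-enumerated atoms ∈-atoms

  ≈θ⊗-refl : t ≈θ⊗ t
  ≈θ⊗-refl = Permutation-refl ≈θ-refl

  exchange-Ω : Ω ↭ Ω′ → Ω ⨾ Θ ∣ Δ ∣ Σ ⊢ σ → Ω′ ⨾ Θ ∣ Δ ∣ Σ ⊢ σ
  exchange-Ω π = exch (↭⇒Permutation ≈ω-refl π) (Permutation-refl ≈θ⊗-refl)
    (Permutation-refl ↭-refl) (Permutation-refl ↭-refl) ↭-refl

  exchange-Δ : Δ ↭ Δ′ → Ω ⨾ Θ ∣ Δ ∣ Σ ⊢ σ → Ω ⨾ Θ ∣ Δ′ ∣ Σ ⊢ σ
  exchange-Δ π = exch (Permutation-refl ≈ω-refl) (Permutation-refl ≈θ⊗-refl)
    (↭⇒Permutation ↭-refl π) (Permutation-refl ↭-refl) ↭-refl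

  exchange-Σ : Σ ↭ Σ′ → Ω ⨾ Θ ∣ Δ ∣ Σ ⊢ σ → Ω ⨾ Θ ∣ Δ ∣ Σ′ ⊢ σ
  exchange-Σ π = exch (Permutation-refl ≈ω-refl) (Permutation-refl ≈θ⊗-refl)
    (Permutation-refl ↭-refl) (↭⇒Permutation ↭-refl π) ↭-refl

  exchange-σ : σ ↭ σ′ → Ω ⨾ Θ ∣ Δ ∣ Σ ⊢ σ → Ω ⨾ Θ ∣ Δ ∣ Σ ⊢ σ′
  exchange-σ = exch (Permutation-refl ≈ω-refl) (Permutation-refl ≈θ⊗-refl)
    (Permutation-refl ↭-refl) (Permutation-refl ↭-refl)

  module ⊢-Contexts {Θ Δ Σ σ} =
    Contexts {P = λ Ω → Ω ⨾ Θ ∣ Δ ∣ Σ ⊢ σ} exchange-Ω L-Cont L-Weak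
  module ⊢-Merging-Δ {Ω Θ Σ σ} =
    Merging {P = λ Δ → Ω ⨾ Θ ∣ Δ ∣ Σ ⊢ σ} exchange-Δ ⊗-left-Δ
  module ⊢-Merging-Σ {Ω Θ Δ σ} =
    Merging {P = λ Σ → Ω ⨾ Θ ∣ Δ ∣ Σ ⊢ σ} exchange-Σ ⊗-left-Σ

  -- Joint production of exchanges from a fixed set of formulas

  module _ (Γ : List ω-Prop) where

    open import Algebra.Solver.CommutativeMonoid (++-commutativeMonoid {A = Exchange})
      using (solve; _⊜_; _⊕_) renaming (id to ∅)

    -- p and q are the total left and right sides of the contracts at hand, d the
    -- exchanges at hand and B all exchanges that are eventually performed. The
    -- contracts X and the exchanges Y are further ones obtained from Γ. All
    -- contracts may be discharged together, since inclusions add up.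
    record Supply (p q d B : δ-Prop) : Set where
      field
        X : List θ-Prop
        Y : List δ-Prop
        X⊆Γ : All (λ θ → Gθ θ ∈ Γ) X
        Y⊆Γ : All (λ δ → Gδ δ ∈ Γ) Y
        {rest} : δ-Prop
        balance : (p ⊗ lefts X) ⊗ rest ↭ q ⊗ rights X
        total : d ⊗ (q ⊗ rights X) ⊗ concat Y ↭ B

    open Supply

    private variable p p′ q q′ d d′ B B′ : δ-Prop

    supply-resp : p ↭ p′ → q ↭ q′ → d ↭ d′ → B ↭ B′ → Supply p q d B → Supply p′ q′ d′ B′
    supply-resp πp πq πd πB s = record
      { X = X s ; Y = Y s ; X⊆Γ = X⊆Γ s ; Y⊆Γ = Y⊆Γ s
      ; balance = ↭-trans (++⁺ʳ (rest s) (++⁺ʳ (lefts (X s)) (↭-sym πp)))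
                    (↭-trans (balance s) (++⁺ʳ (rights (X s)) πq))
      ; total = ↭-trans (++⁺ (↭-sym πd) (++⁺ʳ (concat (Y s)) (++⁺ʳ (rights (X s)) (↭-sym πq))))
                  (↭-trans (total s) πB)
      }

    supply-given : Supply [] [] B B
    supply-given {B} = record
      { X = [] ; Y = [] ; X⊆Γ = [] ; Y⊆Γ = [] ; balance = ↭-refl ; total = ++-identityʳ B }

    supply-++ : Supply p q d B → Supply p′ q′ d′ B′ →
                Supply (p ⊗ p′) (q ⊗ q′) (d ⊗ d′) (B ⊗ B′)
    supply-++ {p} {q} {d} {B} {p′} {q′} {d′} {B′} s s′ = record
      { X = X s ++ X s′ ; Y = Y s ++ Y s′
      ; X⊆Γ = All-++⁺ (X⊆Γ s) (X⊆Γ s′) ; Y⊆Γ = All-++⁺ (Y⊆Γ s) (Y⊆Γ s′)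
      ; balance = bal
      ; total = tot
      }
      where
      ls = lefts (X s)
      ls′ = lefts (X s′)
      rs = rights (X s)
      rs′ = rights (X s′)
      bal : ((p ⊗ p′) ⊗ lefts (X s ++ X s′)) ⊗ (rest s ⊗ rest s′) ↭ (q ⊗ q′) ⊗ rights (X s ++ X s′)
      bal rewrite concatMap-++ left (X s) (X s′) | concatMap-++ right (X s) (X s′) =
        ↭-trans (solve 6 (λ p p′ l l′ z z′ →
                  ((p ⊕ p′) ⊕ (l ⊕ l′)) ⊕ (z ⊕ z′) ⊜ ((p ⊕ l) ⊕ z) ⊕ ((p′ ⊕ l′) ⊕ z′))
                  ↭-refl p p′ ls ls′ (rest s) (rest s′))
        (↭-trans (++⁺ (balance s) (balance s′))
          (solve 4 (λ q r q′ r′ → (q ⊕ r) ⊕ (q′ ⊕ r′) ⊜ (q ⊕ q′) ⊕ (r ⊕ r′)) ↭-refl q rs q′ rs′))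
      tot : (d ⊗ d′) ⊗ ((q ⊗ q′) ⊗ rights (X s ++ X s′)) ⊗ concat (Y s ++ Y s′) ↭ B ⊗ B′
      tot rewrite concatMap-++ right (X s) (X s′) | sym (concat-++ (Y s) (Y s′)) =
        ↭-trans (solve 8 (λ d d′ q q′ r r′ y y′ →
                  (d ⊕ d′) ⊕ (((q ⊕ q′) ⊕ (r ⊕ r′)) ⊕ (y ⊕ y′)) ⊜
                  (d ⊕ ((q ⊕ r) ⊕ y)) ⊕ (d′ ⊕ ((q′ ⊕ r′) ⊕ y′)))
                  ↭-refl d d′ q q′ rs rs′ (concat (Y s)) (concat (Y s′)))
          (++⁺ (total s) (total s′))

    -- This mirrors `⊸⊸-left` from premise to conclusion: `δ′` moves from the exchanges at hand to
    -- the contracts at hand, and the slack `z` of the inclusion joins `rest`.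
    supply-contract : δ ⊆ₘ δ′ → Supply p q (δ′ ⊗ d) B → Supply (δ ⊗ p) (δ′ ⊗ q) d B
    supply-contract {δ} {δ′} {p} {q} {d} (z , π) s = record
      { X = X s ; Y = Y s ; X⊆Γ = X⊆Γ s ; Y⊆Γ = Y⊆Γ s
      ; rest = z ⊗ rest s
      ; balance = ↭-trans (solve 5 (λ δ p l z z′ → ((δ ⊕ p) ⊕ l) ⊕ (z ⊕ z′) ⊜ (δ ⊕ z) ⊕ ((p ⊕ l) ⊕ z′))
                    ↭-refl δ p (lefts (X s)) z (rest s))
          (↭-trans (++⁺ π (balance s))
            (solve 3 (λ δ q r → δ ⊕ (q ⊕ r) ⊜ (δ ⊕ q) ⊕ r) ↭-refl δ′ q (rights (X s))))
      ; total = ↭-trans (solve 5 (λ d δ q r y → d ⊕ (((δ ⊕ q) ⊕ r) ⊕ y) ⊜ (δ ⊕ d) ⊕ ((q ⊕ r) ⊕ y))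
                    ↭-refl d δ′ q (rights (X s)) (concat (Y s)))
                  (total s)
      }

    supply-Gθ : Gθ θ ∈ Γ → Supply (left θ ⊗ p) (right θ ⊗ q) d B → Supply p q d B
    supply-Gθ {θ} {p} {q} {d} θ∈Γ s = record
      { X = θ ∷ X s ; Y = Y s ; X⊆Γ = θ∈Γ ∷ X⊆Γ s ; Y⊆Γ = Y⊆Γ s
      ; balance = ↭-trans (++⁺ʳ (rest s) (swap-front p (left θ) (lefts (X s))))
          (↭-trans (balance s) (↭-sym (swap-front q (right θ) (rights (X s)))))
      ; total = ↭-trans (++⁺ˡ d (++⁺ʳ (concat (Y s)) (swap-front q (right θ) (rights (X s)))))
                  (total s)
      }
      where
      swap-front : (u v w : δ-Prop) → u ⊗ (v ⊗ w) ↭ (v ⊗ u) ⊗ w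
      swap-front = solve 3 (λ u v w → u ⊕ (v ⊕ w) ⊜ (v ⊕ u) ⊕ w) ↭-refl

    supply-Gδ : Gδ δ ∈ Γ → Supply p q (δ ⊗ d) B → Supply p q d B
    supply-Gδ {δ} {p} {q} {d} δ∈Γ s = record
      { X = X s ; Y = δ ∷ Y s ; X⊆Γ = X⊆Γ s ; Y⊆Γ = δ∈Γ ∷ Y⊆Γ s
      ; balance = balance s
      ; total = ↭-trans (solve 4 (λ d r δ y → d ⊕ (r ⊕ (δ ⊕ y)) ⊜ (δ ⊕ d) ⊕ (r ⊕ y))
                  ↭-refl d (q ⊗ rights (X s)) δ (concat (Y s)))
                  (total s)
      }

    -- Nonemptiness serves twice: every item contributes an exchange, which bounds the search, and
    -- what the items yield can be assembled by the left tensor rules.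
    Contract Offer : Set
    Contract = ∃ λ θ → Gθ θ ∈ Γ × right θ ≢ []
    Offer    = ∃ λ δ → Gδ δ ∈ Γ × δ ≢ []

    contractLefts contractRights : List Contract → δ-Prop
    contractLefts  = concatMap (left ∘ proj₁)
    contractRights = concatMap (right ∘ proj₁)

    offered : List Offer → δ-Prop
    offered = concatMap proj₁

    Produces : List Contract → List Offer → δ-Prop → Set
    Produces X Y B = contractLefts X ⊆ₘ contractRights X × offered Y ⊗ contractRights X ↭ B

    Producible : δ-Prop → Set
    Producible B = ∃ λ X → ∃ λ Y → Produces X Y B

    -- A contract with empty right side adds nothing to the total of right sides and only burdens
    -- the total of left sides. Dropping it preserves the balance; its left side becomes part of the
    -- slack.
    prune-contracts : ∀ X → All (λ θ → Gθ θ ∈ Γ) X →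
      ∃ λ X′ → contractLefts X′ ⊆ₘ lefts X × contractRights X′ ≡ rights X
    prune-contracts [] [] = [] , ([] , ↭-refl) , refl
    prune-contracts (θ@(δ₁ ⊸⊸ δ₂) ∷ X) (θ∈Γ ∷ X⊆Γ) with prune-contracts X X⊆Γ | δ₂
    ... | X′ , (z , π) , eq | [] = X′ , (δ₁ ⊗ z , ↭-trans (shifts (contractLefts X′) δ₁) (++⁺ˡ δ₁ π)) , eq
    ... | X′ , (z , π) , eq | e ∷ δ₃ = (_ , θ∈Γ , λ ()) ∷ X′ ,
      (z , ↭-trans (++-assoc δ₁ (contractLefts X′) z) (++⁺ˡ δ₁ π)) , cong ((e ∷ δ₃) ⊗_) eq

    prune-offers : ∀ Y → All (λ δ → Gδ δ ∈ Γ) Y → ∃ λ Y′ → offered Y′ ≡ concat Y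
    prune-offers [] [] = [] , refl
    prune-offers ([] ∷ Y) (_ ∷ Y⊆Γ) = prune-offers Y Y⊆Γ
    prune-offers (δ@(_ ∷ _) ∷ Y) (δ∈Γ ∷ Y⊆Γ) with prune-offers Y Y⊆Γ
    ... | Y′ , eq = (δ , δ∈Γ , λ ()) ∷ Y′ , cong (δ ⊗_) eq

    supply⇒producible : Supply [] [] [] B → Producible B
    supply⇒producible s with prune-contracts (X s) (X⊆Γ s) | prune-offers (Y s) (Y⊆Γ s)
    ... | X′ , (z , π) , eqX | Y′ , eqY = X′ , Y′ ,
      (z ⊗ rest s , ↭-trans (↭-sym (++-assoc (contractLefts X′) z (rest s)))
        (↭-trans (++⁺ʳ (rest s) π) (↭-trans (balance s) (↭-reflexive (sym eqX))))) ,
      ↭-trans (↭-reflexive (cong₂ _⊗_ eqY eqX))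
        (↭-trans (++-comm (concat (Y s)) (rights (X s))) (total s))

    -- Links and plans

    Step : Rel Atom 0ℓ
    Step a b = Producible ⟦ a ⊸ b ⟧

    -- The premise of `⊸-left` is initial with a single goal, so each step of a chain starts afresh
    -- from `Γ` and balances its own contracts; different steps cannot pool theirs.
    Reach : Rel Atom 0ℓ
    Reach = Star Step

    -- The history of one atom: it travels along single-exchange productions
    -- and then takes part at most once in the joint production.
    data Link : Set where
      idle : (c b : Atom) → Link
      via  : (c a b : Atom) → Link

    source target : Link → Atom
    source (idle c _)  = c
    source (via c _ _) = c
    target (idle _ b)  = b
    target (via _ _ b) = b

    exchanges : Link → δ-Prop
    exchanges (idle _ _)  = []
    exchanges (via _ a b) = ⟦ a ⊸ b ⟧

    -- The exchange of `via` is left out here, because it is accounted for jointly with those of the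
    -- other links.
    Valid : Link → Set
    Valid (idle c b)  = Reach c b
    Valid (via c a _) = Reach c a

    -- `Σ-nonempty` reflects that linear formulas cannot be weakened and the unit has no left rule:
    -- a sequent with `I` in `Σ` is never derivable.
    record Plan (Θ : List θ-Tensor) (Δ : List δ-Prop) (Σ : List σ-Prop) (σ : σ-Prop) : Set where
      field
        Σ-nonempty : All (_≢ []) Σ
        links      : List Link
        valid      : All Valid links
        sources    : map source links ↭ concat Σ
        targets    : map target links ↭ σ
        supply     : Supply (tensorLefts Θ) (tensorRights Θ) (concat Δ) (concatMap exchanges links)

    open Plan

    map-supply : (∀ {B} → Supply (tensorLefts Θ) (tensorRights Θ) (concat Δ) B →
                          Supply (tensorLefts Θ′) (tensorRights Θ′) (concat Δ′) B) →
                 Plan Θ Δ Σ σ → Plan Θ′ Δ′ Σ σ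
    map-supply f P = record
      { Σ-nonempty = Σ-nonempty P ; links = links P ; valid = valid P
      ; sources = sources P ; targets = targets P ; supply = f (supply P) }

    plan-exch : Permutation _≈θ⊗_ Θ Θ′ → Permutation _↭_ Δ Δ′ → Permutation _↭_ Σ Σ′ → σ ↭ σ′ →
                Plan Θ Δ Σ σ → Plan Θ′ Δ′ Σ′ σ′
    plan-exch πΘ πΔ πΣ πσ P = record
      { Σ-nonempty = All-resp-Permutation
          (λ { π x≢[] refl → x≢[] (↭-empty-inv π) }) πΣ (Σ-nonempty P)
      ; links   = links P
      ; valid   = valid P
      ; sources = ↭-trans (sources P) (concat-↭ πΣ)
      ; targets = ↭-trans (targets P) πσ
      ; supply  = supply-resp (tensorLefts-resp πΘ) (tensorRights-resp πΘ) (concat-↭ πΔ) ↭-refl (supply P)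
      }

    plan-⊗ : Plan Θ Δ Σ σ → Plan Θ′ Δ′ Σ′ σ′ → Plan (Θ ++ Θ′) (Δ ++ Δ′) (Σ ++ Σ′) (σ ⊗ σ′)
    plan-⊗ {Θ} {Δ} {Σ} {Θ′ = Θ′} {Δ′} {Σ′} P P′ = record
      { Σ-nonempty = All-++⁺ (Σ-nonempty P) (Σ-nonempty P′)
      ; links   = links P ++ links P′
      ; valid   = All-++⁺ (valid P) (valid P′)
      ; sources = ↭-trans (↭-reflexive (map-++ source (links P) (links P′)))
                    (↭-trans (++⁺ (sources P) (sources P′)) (↭-reflexive (concat-++ Σ Σ′)))
      ; targets = ↭-trans (↭-reflexive (map-++ target (links P) (links P′)))
                    (++⁺ (targets P) (targets P′))
      ; supply  = supply-resp
          (↭-reflexive (sym (concatMap-++ (lefts ∘ toList) Θ Θ′)))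
          (↭-reflexive (sym (concatMap-++ (rights ∘ toList) Θ Θ′)))
          (↭-reflexive (concat-++ Δ Δ′))
          (↭-reflexive (sym (concatMap-++ exchanges (links P) (links P′))))
          (supply-++ (supply P) (supply P′))
      }

    -- One goal means one link. If that link is `via`, its exchange is the entire joint production,
    -- hence a `Step` that prolongs the chain. This frees the new plan in `plan-⊸` to perform one
    -- more exchange.
    single-link : (P : Plan [] [] Σ ⟦ a ⟧) → ∃ λ c → Reach c a × c ∷ [] ↭ concat Σ
    single-link record { links = links ; valid = valid ; sources = sources
                       ; targets = targets ; supply = supply }
      with links | ↭-singleton-inv targets | valid
    ... | idle c b ∷ []  | refl | r ∷ [] = c , r , sources
    ... | via c a b ∷ [] | refl | r ∷ [] = c , r ◅◅ (supply⇒producible supply ◅ ε) , sources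

    plan-⊸ : Plan [] [] Σ ⟦ a ⟧ → Plan [] (⟦ a ⊸ b ⟧ ∷ []) Σ ⟦ b ⟧
    plan-⊸ {a = a} {b} P with single-link P
    ... | c , r , π = record
      { Σ-nonempty = Σ-nonempty P
      ; links = via c a b ∷ [] ; valid = r ∷ [] ; sources = π ; targets = ↭-refl ; supply = supply-given }

    -- From derivations to plans

    module Extraction (ℳ : Model) (w : Model.World ℳ)
      (contract∈Γ : ∀ {θ} → Model.V ℳ w (Gθ θ) → ∃ λ θ′ → θ ≈θ θ′ × Gθ θ′ ∈ Γ)
      (offer∈Γ    : ∀ {δ} → Model.V ℳ w (Gδ δ) → ∃ λ δ′ → δ ↭ δ′ × Gδ δ′ ∈ Γ) where

      open Forcing ℳ

      -- `Ω` enters only through what `w` forces, so `soundness` disposes of the premises in `_⊩_`,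
      -- including that of `Ω-cut`. The linear rules act on the plan alone.
      extract : Ω ⨾ Θ ∣ Δ ∣ Σ ⊢ σ → w ⊨* Ω → Plan Θ Δ Σ σ
      extract (exch πΩ πΘ πΔ πΣ πσ d) fs = plan-exch πΘ πΔ πΣ πσ (extract d (⊨*-resp-≈ πΩ fs))
      extract (L-Cont d) (f ∷ fs) = extract d (f ∷ f ∷ fs)
      extract (L-Weak d) (f ∷ fs) = extract d fs
      extract (L-∧-left₁ d) ((f , _) ∷ fs) = extract d (f ∷ fs)
      extract (L-∧-left₂ d) ((_ , g) ∷ fs) = extract d (g ∷ fs)
      extract (L-⇒-left {Ω} d e) (f ∷ fs) =
        extract e (f (Model.≼-refl ℳ) (soundness d (++⁻ˡ Ω fs)) ∷ ++⁻ʳ Ω fs)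
      extract I-right fs = record
        { Σ-nonempty = [] ; links = [] ; valid = [] ; sources = ↭-refl ; targets = ↭-refl
        ; supply = supply-given }
      extract (Σ-Ax {a = a}) fs = record
        { Σ-nonempty = (λ ()) ∷ [] ; links = idle a a ∷ [] ; valid = ε ∷ []
        ; sources = ↭-refl ; targets = ↭-refl ; supply = supply-given }
      extract (⊗-left-Θ {t = t@(_ ∷ _)} {t′ = t′@(_ ∷ _)} {Θ = Θ} d) fs =
        map-supply {Θ = t ∷ t′ ∷ Θ} (supply-resp (flatten left) (flatten right) ↭-refl ↭-refl) (extract d fs)
        where
        flatten : (f : θ-Prop → δ-Prop) → let g = concatMap f ∘ toList in
          g t ⊗ (g t′ ⊗ concatMap g Θ) ↭ concatMap f (toList t ++ toList t′) ⊗ concatMap g Θ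
        flatten f = ↭-trans (↭-sym (++-assoc (concatMap f (toList t)) (concatMap f (toList t′)) _))
          (++⁺ʳ _ (↭-reflexive (sym (concatMap-++ f (toList t) (toList t′)))))
      extract (⊗-left-Δ {δ = δ} {δ′ = δ′} {Δ = Δ} d) fs =
        map-supply {Δ = δ ∷ δ′ ∷ Δ}
          (supply-resp ↭-refl ↭-refl (↭-sym (++-assoc δ δ′ (concat Δ))) ↭-refl) (extract d fs)
      extract (⊗-left-Σ {x = x} {y = y} {Σ = Σ} d) fs with extract d fs
      ... | record { Σ-nonempty = x≢[] ∷ _ ∷ Σ≢[] ; links = L ; valid = v
                   ; sources = s ; targets = t ; supply = S } = record
        { Σ-nonempty = (λ xy≡[] → x≢[] (++-conicalˡ x y xy≡[])) ∷ Σ≢[]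
        ; links = L ; valid = v ; sources = ↭-trans s (↭-sym (++-assoc x y (concat Σ)))
        ; targets = t ; supply = S }
      extract (⊗-right d e) fs = plan-⊗ (extract d fs) (extract e fs)
      extract (⊸-left d) fs = plan-⊸ (extract d fs)
      extract (⊸⊸-left {δ = δ} {δ′ = δ′} {Θ = Θ} {Δ = Δ} i d) fs =
        map-supply {Δ = δ′ ∷ Δ} (λ s → supply-resp
          (++⁺ʳ (tensorLefts Θ) (↭-sym (++-identityʳ δ))) (++⁺ʳ (tensorRights Θ) (↭-sym (++-identityʳ δ′)))
          ↭-refl ↭-refl (supply-contract i s)) (extract d fs)
      extract (⊸⊸-split {δ = δ} {δ″ = δ″} {δ′ = δ′} {δ‴ = δ‴} {Θ = Θ} d) fs =
        map-supply {Θ = _ ∷ Θ}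
          (supply-resp (regroup δ δ″ (tensorLefts Θ)) (regroup δ′ δ‴ (tensorRights Θ)) ↭-refl ↭-refl)
          (extract d fs)
        where
        regroup : (u v w : δ-Prop) → ((u ⊗ v) ⊗ []) ⊗ w ↭ (u ⊗ []) ⊗ ((v ⊗ []) ⊗ w)
        regroup = solve 3 (λ u v w → ((u ⊕ v) ⊕ ∅) ⊕ w ⊜ (u ⊕ ∅) ⊕ ((v ⊕ ∅) ⊕ w)) ↭-refl
      extract (G-left-θ {θ = θ@(δ₁ ⊸⊸ δ₂)} {Θ = Θ} d) (f ∷ fs) with contract∈Γ {θ} f
      ... | θ′ , π ⊸⊸ ρ , θ′∈Γ =
        map-supply {Θ = _ ∷ Θ} (λ s → supply-Gθ θ′∈Γ (supply-resp
          (++⁺ʳ (tensorLefts Θ) (↭-trans (++-identityʳ δ₁) π)) (++⁺ʳ (tensorRights Θ) (↭-trans (++-identityʳ δ₂) ρ))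
          ↭-refl ↭-refl s)) (extract d fs)
      extract (G-left-δ {δ = δ} {Δ = Δ} d) (f ∷ fs) with offer∈Γ {δ} f
      ... | δ′ , π , δ′∈Γ =
        map-supply {Δ = δ ∷ Δ}
          (λ s → supply-Gδ δ′∈Γ (supply-resp ↭-refl ↭-refl (++⁺ʳ (concat Δ) π) ↭-refl s)) (extract d fs)
      extract (Ω-cut {Ω} d e) fs = extract e (soundness d (++⁻ˡ Ω fs) ∷ ++⁻ʳ Ω fs)

    -- Deciding whether a plan exists

    search-contracts : Searchable (Contract)
    search-contracts {P} P? = map′
      (λ { ((Gθ θ , i) , ne , p) → (θ , i , ne) , p })
      (λ { ((θ , i , ne) , p) → (Gθ θ , i) , ne , p })
      (search-members Γ {Q} Q?)
      where
      Q : ∃ (_∈ Γ) → Set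
      Q (Gθ θ , i) = ∃ λ ne → P (θ , i , ne)
      Q _ = ⊥
      Q? : ∀ m → Dec (Q m)
      Q? (Gθ θ , i) with nonempty? (right θ)
      -- All proofs of `right θ ≢ []` are definitionally equal, so testing `P` at one of them covers
      -- every contract on `θ` and `i`.
      ... | yes ne   = map′ (ne ,_) proj₂ (P? (θ , i , ne))
      ... | no empty = no λ (ne , _) → empty ne
      Q? (⊤ , _) = no λ ()
      Q? (pred _ _ , _) = no λ ()
      Q? ((_ ∧ _) , _) = no λ ()
      Q? ((_ ⇒ _) , _) = no λ ()
      Q? (Gδ _ , _) = no λ ()

    search-offers : Searchable (Offer)
    search-offers {P} P? = map′
      (λ { ((Gδ δ , i) , ne , p) → (δ , i , ne) , p })
      (λ { ((δ , i , ne) , p) → (Gδ δ , i) , ne , p })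
      (search-members Γ {Q} Q?)
      where
      Q : ∃ (_∈ Γ) → Set
      Q (Gδ δ , i) = ∃ λ ne → P (δ , i , ne)
      Q _ = ⊥
      Q? : ∀ m → Dec (Q m)
      Q? (Gδ δ , i) with nonempty? δ
      ... | yes ne   = map′ (ne ,_) proj₂ (P? (δ , i , ne))
      ... | no empty = no λ (ne , _) → empty ne
      Q? (⊤ , _) = no λ ()
      Q? (pred _ _ , _) = no λ ()
      Q? ((_ ∧ _) , _) = no λ ()
      Q? ((_ ⇒ _) , _) = no λ ()
      Q? (Gθ _ , _) = no λ ()

    -- Each contract and each offer puts at least one exchange into `B`, so neither list is longer
    -- than `B`.
    producible? : ∀ B → Dec (Producible B)
    producible? B = map′
      (λ (X , _ , Y , _ , p) → X , Y , p)
      (λ (X , Y , p@(_ , total)) → let bound = ↭-length total in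
        X , ≤-trans (length≤concatMap _ (proj₂ ∘ proj₂) X)
              (≤-trans (length-++-≤ʳ _ {offered Y}) (≤-reflexive bound)) ,
        Y , ≤-trans (length≤concatMap _ (proj₂ ∘ proj₂) Y)
              (≤-trans (length-++-≤ˡ (offered Y)) (≤-reflexive bound)) , p)
      (search-lists search-contracts (length B) λ X →
       search-lists search-offers (length B) λ Y →
         ⊆ₘ? _≟ₑ_ _ _ ×-dec ↭? _≟ₑ_ _ _)

    step? : Decidable (Step)
    step? a b = producible? ⟦ a ⊸ b ⟧

    reach? : Decidable (Reach)
    reach? c b = map′
      (Star.map (λ i → proj₂ (∈-filter⁻ (uncurry step?) {xs = cartesianProduct atoms atoms} i)))
      (Star.map (λ s → ∈-filter⁺ (uncurry step?) (∈-cartesianProduct⁺ (∈-atoms _) (∈-atoms _)) s))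
      (path? _≟ₐ_ (filter (uncurry step?) (cartesianProduct atoms atoms)) c b)

    search-links : Searchable (Link)
    search-links P? = map′
      (λ { (inj₁ (c , b , p)) → idle c b , p ; (inj₂ (c , a , b , p)) → via c a b , p })
      (λ { (idle c b , p) → inj₁ (c , b , p) ; (via c a b , p) → inj₂ (c , a , b , p) })
      (search-atoms (λ c → search-atoms λ b → P? (idle c b)) ⊎-dec
       search-atoms (λ c → search-atoms λ a → search-atoms λ b → P? (via c a b)))

    valid? : ∀ l → Dec (Valid l)
    valid? (idle c b)  = reach? c b
    valid? (via c a _) = reach? c a

    InitialPlan : List σ-Prop → σ-Prop → Set
    InitialPlan Σ σ = All (_≢ []) Σ × ∃ λ L →
      All (Valid) L × map source L ↭ concat Σ × map target L ↭ σ ×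
      Producible (concatMap exchanges L)

    initialPlan? : ∀ Σ σ → Dec (InitialPlan Σ σ)
    initialPlan? Σ σ = All.all? nonempty? Σ ×-dec map′
      (λ (L , _ , p) → L , p)
      (λ (L , p@(_ , _ , targets , _)) →
        L , ≤-reflexive (trans (sym (length-map _ L)) (↭-length targets)) , p)
      (search-lists search-links (length σ) λ L →
        All.all? valid? L ×-dec (↭? _≟ₐ_ _ _ ×-dec (↭? _≟ₐ_ _ _ ×-dec producible? _)))

    plan⇒initial : Plan [] [] Σ σ → InitialPlan Σ σ
    plan⇒initial P =
      Σ-nonempty P , links P , valid P , sources P , targets P , supply⇒producible (supply P)

    -- From plans to derivations

    module Realisation {Ω} (Γ⊩ : ∀ {ω} → ω ∈ Γ → Ω ⊩ ω) where

      cut-Γ : ω ∈ Γ → ω ∷ Ω ⨾ Θ ∣ Δ ∣ Σ ⊢ σ → Ω ⨾ Θ ∣ Δ ∣ Σ ⊢ σ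
      cut-Γ i d = ⊢-Contexts.resize (λ j → [ id , id ]′ (∈-++⁻ Ω j)) (Ω-cut (Γ⊩ i) d)

      use-offers : ∀ Y → Ω ⨾ Θ ∣ map ⟦_⟧ (offered Y) ++ Δ ∣ Σ ⊢ σ → Ω ⨾ Θ ∣ Δ ∣ Σ ⊢ σ
      use-offers [] d = d
      use-offers {Θ} {Δ} {Σ} {σ} ((δ , i , δ≢[]) ∷ Y) d =
        use-offers Y (cut-Γ i (G-left-δ (⊢-Merging-Δ.merge-factors δ≢[]
          (subst (λ Δ → Ω ⨾ Θ ∣ Δ ∣ Σ ⊢ σ)
            (trans (cong (_++ Δ) (map-++ ⟦_⟧ δ (offered Y))) (List.++-assoc (map ⟦_⟧ δ) _ Δ)) d))))

      -- Read upwards, each contract is fetched by a cut and `G-left-θ`, and then `⊸⊸-split` fuses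
      -- it with the rest. Fusion needs a contract to start from, hence a nonempty family.
      use-contracts : ∀ c X → let X⁺ = c ∷ X in
        Ω ⨾ ((contractLefts X⁺ ⊸⊸ contractRights X⁺) ∷ []) ∷ Θ ∣ Δ ∣ Σ ⊢ σ →
        Ω ⨾ Θ ∣ Δ ∣ Σ ⊢ σ
      use-contracts (δ₁ ⊸⊸ δ₂ , i , _) [] d = cut-Γ i (G-left-θ (exch
        (Permutation-refl ≈ω-refl)
        (Hom.prep (Hom.prep (++-identityʳ δ₁ ⊸⊸ ++-identityʳ δ₂) (Hom.refl [])) (Permutation-refl ≈θ⊗-refl))
        (Permutation-refl ↭-refl) (Permutation-refl ↭-refl) ↭-refl d))
      use-contracts (δ₁ ⊸⊸ δ₂ , i , _) (c ∷ X) d =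
        use-contracts c X (cut-Γ i (G-left-θ (⊸⊸-split d)))

      produce : ∀ {B} → Producible B → Ω ⨾ [] ∣ map ⟦_⟧ B ∣ Σ ⊢ σ → Ω ⨾ [] ∣ [] ∣ Σ ⊢ σ
      produce {Σ} {σ} (X , Y , X-balanced , total) d = finish X X-balanced (use-offers Y
        (subst (λ Δ → Ω ⨾ [] ∣ Δ ∣ Σ ⊢ σ) (map-++ ⟦_⟧ (offered Y) (contractRights X))
          (exchange-Δ (↭-map⁺ ⟦_⟧ (↭-sym total)) d)))
        where
        finish : ∀ X → contractLefts X ⊆ₘ contractRights X →
          Ω ⨾ [] ∣ map ⟦_⟧ (contractRights X) ∣ Σ ⊢ σ → Ω ⨾ [] ∣ [] ∣ Σ ⊢ σ
        -- Without contracts there is nothing to assemble. Discharging a contract with empty sides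
        -- would instead leave a unit in `Δ`.
        finish [] _ d = d
        finish X⁺@(c@(_ , _ , c≢[]) ∷ X) balanced d = use-contracts c X (⊸⊸-left balanced
          (⊢-Merging-Δ.merge-factors (λ eq → c≢[] (++-conicalˡ _ _ eq))
            (exchange-Δ (↭-sym (++-identityʳ _)) d)))

      walk : ∀ {c a b} → Ω ⨾ [] ∣ [] ∣ ⟦ c ⟧ ∷ [] ⊢ ⟦ a ⟧ → Reach a b →
             Ω ⨾ [] ∣ [] ∣ ⟦ c ⟧ ∷ [] ⊢ ⟦ b ⟧
      walk d ε       = d
      walk d (s ◅ r) = walk (produce s (⊸-left d)) r

      -- `⊗-right` shares `Ω` between its premises, so every link has all of `Ω` for its own walk,
      -- while the joint exchanges are distributed among the links.
      realise-links : ∀ L → All (Valid) L →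
        Ω ⨾ [] ∣ map ⟦_⟧ (concatMap exchanges L) ∣ map ⟦_⟧ (map source L) ⊢ map target L
      realise-links [] [] = ⊢-Contexts.resize (λ ()) I-right
      realise-links (idle c b ∷ L)  (r ∷ v) = ⊗-right (walk Σ-Ax r) (realise-links L v)
      realise-links (via c a b ∷ L) (r ∷ v) = ⊗-right (⊸-left (walk Σ-Ax r)) (realise-links L v)

      realise : InitialPlan Σ σ → ValidInitial Ω Σ σ
      realise {Σ} {σ} (Σ-nonempty , L , valid , sources , targets , producible) =
        subst (λ Σ → Ω ⨾ [] ∣ [] ∣ Σ ⊢ σ) (List.++-identityʳ Σ)
          (⊢-Merging-Σ.merge-all-factors [] Σ-nonempty
            (exchange-Σ (↭-trans (↭-map⁺ ⟦_⟧ sources) (↭-sym (++-identityʳ _)))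
              (produce producible (exchange-σ targets (realise-links L valid)))))

  -- The decision procedure

  validInitial? : ∀ Ω Σ σ → Dec (ValidInitial Ω Σ σ)
  validInitial? Ω Σ σ = decide (saturate contextModel Ω)
    where
    open Saturation (concatMap subformulas Ω) (subformulas-closed Ω)
    open Forcing saturatedModel

    decide : Saturation contextModel Ω → Dec (ValidInitial Ω Σ σ)
    decide (Γ , Ω⊆Γ , s , Ω⊫Γ) = map′
      -- Two models meet at `Γ`. In the model of contexts `Ω` forces itself, hence all of `Γ`, which
      -- makes the members of `Γ` derivable from `Ω`. As a world of `saturatedModel`, `Γ` forces `Ω`
      -- but no contract or offer outside itself, so plans extracted there use only members of `Γ`.
      (Realisation.realise Γ λ {ω} i → reify ω (All.lookup (Ω⊫Γ (context-forces Ω)) i))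
      (λ d → plan⇒initial Γ (extract d forced))
      (initialPlan? Γ Σ σ)
      where
      contract∈Γ : ∀ {θ} → Gθ θ ∈≈ Γ → ∃ λ θ′ → θ ≈θ θ′ × Gθ θ′ ∈ Γ
      contract∈Γ i = case find i of λ { (_ , θ′∈Γ , Gθ e) → _ , e , θ′∈Γ }

      offer∈Γ : ∀ {δ} → Gδ δ ∈≈ Γ → ∃ λ δ′ → δ ↭ δ′ × Gδ δ′ ∈ Γ
      offer∈Γ i = case find i of λ { (_ , δ′∈Γ , Gδ π) → _ , π , δ′∈Γ }

      open Extraction Γ saturatedModel (Γ , s) contract∈Γ offer∈Γ

      forced : (Γ , s) ⊨* Ω
      forced = All.tabulate λ {ω} ω∈Ω → member⇒forced ω s
        (∈-concatMap⁺ subformulas (lose ω∈Ω (self∈subformulas ω)))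
        (Ω⊆Γ (lose ω∈Ω ≈ω-refl))

theorem5p6 : (𝒮 : Signature) → let open MuACL 𝒮 in
    (Ω : List ω-Prop) (Σ : List σ-Prop) (σ : σ-Prop) → Dec (ValidInitial Ω Σ σ)
theorem5p6 = validInitial?
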